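{- Let $K$ be an edge-homogeneous map on the torus with edge-symbol $(m,\ell;u,v)$, and let $N$ be the number of orbits of the action of ${\rm Aut}(K)$ on the edge set $E(K)$. (a) If $(m,\ell;u,v)\in\{(3,3;6,6),(6,6;3,3),(3,6;4,4),(4,4;3,6)\}$, then $N\le 3$. (b) If $(m,\ell;u,v)=(4,4;4,4)$, then $N\le 2$. (c) The bounds in (a) and (b) are sharp, i.e. for each of these edge-symbols there exists a map on the torus with that edge-symbol attaining the stated bound.
   Context: A map is an embedding of a graph on a surface such that the closures of the components of the complement of the graph (the faces) are closed 2-discs, and any two distinct faces intersect in the empty set, a common vertex, or a common edge. An edge has edge-symbol $(m,\ell;u,v)$ if its two end vertices have valences $u$ and $v$ and its two incident faces have sizes $m$ and $\ell$. A map is edge-homogeneous if all its edges have the same edge-symbol. An automorphism of a map $K$ is a bijection of its vertex set that maps cells (vertices, edges, faces) of $K$ to cells of $K$ and whose inverse does too; ${\rm Aut}(K)$ is the group of automorphisms. -}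

module Defs where

open import Data.Fin.Base using (Fin)
open import Data.Fin.Permutation using (Permutation′; _⟨$⟩ʳ_; flip)
open import Data.Fin.Properties using (_≟_)
open import Data.List.Base using (length; filter; allFin)
open import Data.Nat.Base using (ℕ; _+_; _<_)
open import Data.Nat.GeneralisedArithmetic using (iterate)
open import Data.Product.Base using (∃; _×_; _,_)
open import Data.Sum.Base using (_⊎_)
open import Function.Base using (_∘_)
open import Function.Bundles using (_⇔_)
open import Function.Definitions using (StrictlySurjective)
open import Level using (0ℓ)
open import Relation.Binary.Core using (Rel)
open import Relation.Binary.Construct.Closure.ReflexiveTransitive using (Star)
open import Relation.Binary.PropositionalEquality.Core using (_≡_; _≢_)
open import Relation.Nullary.Negation.Core using (¬_)

-- q exhibits C as the set of equivalence classes of R.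
record IsQuotient {A C : Set} (R : Rel A 0ℓ) (q : A → C) : Set where
  field
    surjective : StrictlySurjective _≡_ q
    classes    : ∀ x y → R x y ⇔ q x ≡ q y

-- Forward iteration suffices: this is only used for permutations of a
-- finite set, where it is an equivalence relation.
InCycle : {A : Set} → (A → A) → Rel A 0ℓ
InCycle f x y = ∃ λ k → iterate f x k ≡ y

-- A cellular embedding of a finite connected graph in a closed oriented
-- surface, given by its rotation system.  A dart is an edge with a chosen
-- direction.  α reverses a dart; σ sends a dart to the next one, in the
-- cyclic order given by the orientation, among those leaving the same
-- vertex; hence φ = σ ∘ α sends a dart to the next one along the boundary
-- of the face on a fixed side of it.  Vertices, edges and faces are the
-- cycles of σ, α and φ; `vertex x` is the vertex that the dart x leaves.
record CellularEmbedding : Set where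
  field
    #darts #vertices #edges #faces : ℕ

  Dart   = Fin #darts
  Vertex = Fin #vertices
  Edge   = Fin #edges
  Face   = Fin #faces

  field
    rotation         : Permutation′ #darts
    α                : Dart → Dart
    α-involutive     : ∀ x → α (α x) ≡ x
    α-fixedPointFree : ∀ x → α x ≢ x

  σ = rotation ⟨$⟩ʳ_
  φ = σ ∘ α

  field
    vertex           : Dart → Vertex
    edge             : Dart → Edge
    face             : Dart → Face
    vertices-cycles  : IsQuotient (InCycle σ) vertex
    edges-cycles     : IsQuotient (InCycle α) edge
    faces-cycles     : IsQuotient (InCycle φ) face
    nonempty         : 0 < #darts
    connected        : ∀ x y → Star (λ a b → σ a ≡ b ⊎ α a ≡ b) x y

  infix 4 _∈ᵉ_ _∈ᶠ_ _⊂ᶠ_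

  _∈ᵉ_ : Vertex → Edge → Set
  v ∈ᵉ e = ∃ λ x → edge x ≡ e × vertex x ≡ v

  _∈ᶠ_ : Vertex → Face → Set
  v ∈ᶠ f = ∃ λ x → face x ≡ f × vertex x ≡ v

  _⊂ᶠ_ : Edge → Face → Set
  e ⊂ᶠ f = ∃ λ x → face x ≡ f × edge x ≡ e

  -- The number of edge ends at v.
  valence : Vertex → ℕ
  valence v = length (filter (λ x → vertex x ≟ v) (allFin #darts))

  -- The length of the boundary walk of f.
  size : Face → ℕ
  size f = length (filter (λ x → face x ≟ f) (allFin #darts))

  -- The closure of a face is a closed disc exactly when its boundary walk
  -- is a simple closed curve, i.e. repeats no vertex and no edge.
  ClosedDiscs : Set
  ClosedDiscs = ∀ x y → face x ≡ face y →
    (vertex x ≡ vertex y → x ≡ y) × (edge x ≡ edge y → x ≡ y)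

  -- Closed faces meet in a union of vertices and (closed) edges, so their
  -- intersection is determined by the vertices and edges common to both.
  MeetEmpty : Face → Face → Set
  MeetEmpty f g = ∀ v → ¬ (v ∈ᶠ f × v ∈ᶠ g)

  MeetInVertex : Face → Face → Vertex → Set
  MeetInVertex f g w =
    (∀ v → (v ∈ᶠ f × v ∈ᶠ g) ⇔ v ≡ w) ×
    (∀ e → ¬ (e ⊂ᶠ f × e ⊂ᶠ g))

  MeetInEdge : Face → Face → Edge → Set
  MeetInEdge f g d =
    (∀ v → (v ∈ᶠ f × v ∈ᶠ g) ⇔ v ∈ᵉ d) ×
    (∀ e → (e ⊂ᶠ f × e ⊂ᶠ g) ⇔ e ≡ d)

  ProperIntersections : Set
  ProperIntersections = ∀ f g → f ≢ g →
    MeetEmpty f g ⊎ ∃ (MeetInVertex f g) ⊎ ∃ (MeetInEdge f g)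

record Map : Set where
  field
    embedding           : CellularEmbedding
  open CellularEmbedding embedding public
  field
    closedDiscs         : ClosedDiscs
    properIntersections : ProperIntersections

-- The torus is the closed connected orientable surface with
-- Euler characteristic V - E + F = 0.
OnTorus : Map → Set
OnTorus K = #vertices + #faces ≡ #edges
  where open Map K

-- (m , ℓ , u , v) stands for the edge-symbol (m,ℓ;u,v).
EdgeSymbol : Set
EdgeSymbol = ℕ × ℕ × ℕ × ℕ

-- {a , b} = {c , d} as unordered pairs (multisets).
SamePair : ℕ → ℕ → ℕ → ℕ → Set
SamePair a b c d = (a ≡ c × b ≡ d) ⊎ (a ≡ d × b ≡ c)

module _ (K : Map) where
  open Map K

  -- The two end vertices of the edge of a dart x are those that x and α x
  -- leave, and its two incident faces are those of x and α x.
  HasEdgeSymbol : Edge → EdgeSymbol → Set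
  HasEdgeSymbol e (m , ℓ , u , v) = ∃ λ x → edge x ≡ e ×
    SamePair (size (face x)) (size (face (α x))) m ℓ ×
    SamePair (valence (vertex x)) (valence (vertex (α x))) u v

  EdgeHomogeneous : EdgeSymbol → Set
  EdgeHomogeneous s = ∀ e → HasEdgeSymbol e s

  -- π maps the vertex set of the first cell onto that of the second.
  MapsEdge : Permutation′ #vertices → Rel Edge 0ℓ
  MapsEdge π e e′ = ∀ v → v ∈ᵉ e ⇔ (π ⟨$⟩ʳ v) ∈ᵉ e′

  MapsFace : Permutation′ #vertices → Rel Face 0ℓ
  MapsFace π f f′ = ∀ v → v ∈ᶠ f ⇔ (π ⟨$⟩ʳ v) ∈ᶠ f′

  MapsCellsToCells : Permutation′ #vertices → Set
  MapsCellsToCells π =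
    (∀ e → ∃ λ e′ → MapsEdge π e e′) × (∀ f → ∃ λ f′ → MapsFace π f f′)

  IsAutomorphism : Permutation′ #vertices → Set
  IsAutomorphism π = MapsCellsToCells π × MapsCellsToCells (flip π)

  SameOrbit : Rel Edge 0ℓ
  SameOrbit e e′ = ∃ λ π → IsAutomorphism π × MapsEdge π e e′

  HasEdgeOrbits : ℕ → Set
  HasEdgeOrbits N = ∃ λ (q : Edge → Fin N) → IsQuotient SameOrbit q

{-# OPTIONS --safe #-}

-- Suppose all vertices have valence 6 and all faces are triangles.  Then
-- A = σ³α moves a dart straight ahead by one edge; A and B = σAσ⁻¹ commute,
-- and every dart is obtained from a fixed one by a rotation σⁱ followed by a
-- translation AᵐBⁿ.  A rotation with i ≢ 0 followed by a translation is
-- conjugate to a rotation about a vertex, edge or face, and so fixes no dart.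
-- Hence the stabilisers of darts consist of translations, so that translations
-- and half-turns of the coordinates are well-defined automorphisms, and i modulo
-- 3 determines the class of a dart.  Quadrangulations are treated in the same
-- way, with i modulo 2.  The symbol (6,6;3,3) is dual to (3,3;6,6); in a map with
-- symbol (3,6;4,4) the darts on hexagons are the darts of a triangulation, and
-- (4,4;3,6) is dual to it.
--
-- The bounds are attained by Cayley maps of cyclic groups, their duals and
-- medials, in which numbers of configurations of vertices lying on common faces
-- distinguish the classes of edges.
module Submission where

open import Defs
open import Data.List.Base using (List; []; _∷_)
open import Data.List.Membership.Propositional using (_∈_)
open import Data.Nat.Base using (ℕ; _≤_)
open import Data.Product.Base using (∃; _×_; _,_)
open import Relation.Binary.PropositionalEquality.Core using (_≡_)

import Algebra.Properties.CommutativeMonoid.Sum as MonoidSum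
open import Data.Bool.Base using (Bool; true; false; not; _∧_; if_then_else_)
import Data.Bool.Properties as Bool
open import Data.Empty using (⊥)
open import Data.Fin.Base using (Fin; toℕ; fromℕ; fromℕ<; punchOut)
open import Data.Fin using (#_)
open import Data.Fin.Permutation using (Permutation′; _⟨$⟩ʳ_; flip; permutation; inverseˡ; inverseʳ; _∘ₚ_)
import Data.Fin.Properties as Fin
open import Data.Integer.Base as ℤ using (ℤ; +_; -[1+_]; 0ℤ; 1ℤ; -1ℤ)
open import Data.Integer.DivMod using (_%ℕ_; _/ℕ_; n%ℕd<d; a≡a%ℕn+[a/ℕn]*n)
import Data.Integer.Properties as ℤ
open import Data.Integer.Tactic.RingSolver using (solve-∀)
open import Data.List.Base using (length; filter; allFin; applyUpTo; _++_; map; concatMap)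
open import Data.List.Membership.Propositional using (find; lose)
open import Data.List.Membership.Propositional.Properties 
  using (∈-∃++; ∈-++⁻; ∈-++⁺ˡ; ∈-++⁺ʳ; ∈-filter⁺; ∈-filter⁻; ∈-allFin; ∈-applyUpTo⁺; ∈-applyUpTo⁻)
open import Data.List.Properties using (length-++; length-applyUpTo)
import Data.List.Relation.Unary.All as All
open import Data.List.Relation.Unary.AllPairs using (_∷_)
open import Data.List.Relation.Unary.Any as Any using (Any; here; there; any?)
open import Data.List.Relation.Unary.Unique.Propositional using (Unique)
import Data.List.Relation.Unary.Unique.Propositional.Properties as Unique
open import Data.Nat.Base as ℕ using (zero; suc; _+_; _*_; _∸_; _<_; _%_; _/_; z≤n; s≤s; z<s)
open import Data.Nat.DivMod using (_mod_; m≡m%n+[m/n]*n; m%n<n)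
open import Data.Nat.GeneralisedArithmetic using (fold; fold-+; iterate; iterate-is-fold)
import Data.Nat.Properties as ℕ
open import Data.Nat.Properties using (_≟_; _<?_)
open import Data.Product.Base using (∃₂; proj₁; proj₂)
open import Data.Sum.Base as Sum using (_⊎_; inj₁; inj₂; [_,_]′)
open import Data.Unit.Base using (tt)
open import Data.Vec.Base using (Vec; []; _∷_; lookup)
open import Function.Base using (_∘_; id)
open import Function.Bundles using (_⇔_; mk⇔; Equivalence)
open import Relation.Binary.Construct.Closure.ReflexiveTransitive using (Star; ε; _◅_; _◅◅_; kleisliStar)
open import Relation.Binary.Definitions using (tri<; tri≈; tri>)
open import Relation.Binary.PropositionalEquality using (_≢_; refl; sym; trans; cong; cong₂; subst; module ≡-Reasoning)
open import Relation.Binary.PropositionalEquality.WithK using (≡-irrelevant)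
open import Relation.Nullary.Decidable
  using (Dec; yes; no; does; ¬?; map′; _×-dec_; _⊎-dec_; _→-dec_; from-yes; decidable-stable; True; toWitness)
open import Relation.Nullary.Negation.Core using (contradiction; ¬_)

open Equivalence using () renaming (to to ⇒; from to ⇐)
open MonoidSum ℕ.+-0-commutativeMonoid using (sum; sum-permute; sum-cong-≗)

-- Translations

-- `A` and `B` move darts along the map; they are not automorphisms, since they need not commute
-- with `σ`. An automorphism commutes with `σ` and `α`; by connectedness it is determined by the
-- image `y` of one dart `x`, and it exists when the same words in `σ` and `α` fix `x` and `y`. This
-- is what ties orbits to stabilisers: translations commute and a half-turn inverts them, so moving
-- `x` by either keeps its stabiliser, whereas a smaller rotation may turn the lattice of
-- translations fixing `x` into another one. Six (or four) rotations modulo the half-turn leave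
-- three (or two) classes. No covering plane is built: everything takes place in the dart set, where
-- coordinates are not unique. The bounds need only these orientation-preserving symmetries. For
-- sharpness, every vertex permutation respecting cells has to be controlled, orientation-reversing
-- ones included, so the distinguishing numbers are built from the incidence of vertices and faces
-- alone.

module IntegerPower {X : Set} (f g : X → X)
  (f∘g : ∀ x → f (g x) ≡ x) (g∘f : ∀ x → g (f x) ≡ x) where

  pow : ℤ → X → X
  pow (+ n)    x = fold x f n
  pow -[1+ n ] x = fold x g (suc n)

  pow-suc : ∀ m x → pow (ℤ.suc m) x ≡ f (pow m x)
  pow-suc (+ n)          x = refl
  pow-suc -[1+ zero ]    x = sym (f∘g x)
  pow-suc -[1+ suc n ]   x = sym (f∘g _)

  pow-pred : ∀ m x → pow (ℤ.pred m) x ≡ g (pow m x)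
  pow-pred (+ zero)   x = refl
  pow-pred (+ suc n)  x = sym (g∘f _)
  pow-pred -[1+ n ]   x = refl

  pow-+ : ∀ m n x → pow (m ℤ.+ n) x ≡ pow m (pow n x)
  pow-+ (+ zero) n x = cong (λ k → pow k x) (ℤ.+-identityˡ n)
  pow-+ (+ suc m) n x = begin
    pow (ℤ.suc (+ m) ℤ.+ n) x   ≡⟨ cong (λ k → pow k x) (ℤ.+-assoc 1ℤ (+ m) n) ⟩
    pow (ℤ.suc (+ m ℤ.+ n)) x   ≡⟨ pow-suc (+ m ℤ.+ n) x ⟩
    f (pow (+ m ℤ.+ n) x)       ≡⟨ cong f (pow-+ (+ m) n x) ⟩
    pow (+ suc m) (pow n x)     ∎
    where open ≡-Reasoning
  pow-+ -[1+ zero ] n x = pow-pred n x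
  pow-+ -[1+ suc m ] n x = begin
    pow (-[1+ suc m ] ℤ.+ n) x        ≡⟨ cong (λ k → pow k x) (ℤ.+-assoc -1ℤ -[1+ m ] n) ⟩
    pow (ℤ.pred (-[1+ m ] ℤ.+ n)) x   ≡⟨ pow-pred (-[1+ m ] ℤ.+ n) x ⟩
    g (pow (-[1+ m ] ℤ.+ n) x)        ≡⟨ cong g (pow-+ -[1+ m ] n x) ⟩
    pow -[1+ suc m ] (pow n x)        ∎
    where open ≡-Reasoning

  pow-commute : (h : X → X) → (∀ x → h (f x) ≡ f (h x)) → ∀ m x → h (pow m x) ≡ pow m (h x)
  pow-commute h hf = go
    where
    hg : ∀ x → h (g x) ≡ g (h x)
    hg x = trans (sym (g∘f _)) (cong g (trans (sym (hf (g x))) (cong h (f∘g x))))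
    go : ∀ m x → h (pow m x) ≡ pow m (h x)
    go (+ zero)      x = refl
    go (+ suc m)     x = trans (hf _) (cong f (go (+ m) x))
    go -[1+ zero ]   x = hg x
    go -[1+ suc m ]  x = trans (hg _) (cong g (go -[1+ m ] x))

module Translations {X : Set} (A A⁻¹ B B⁻¹ : X → X)
  (AA⁻¹ : ∀ x → A (A⁻¹ x) ≡ x) (A⁻¹A : ∀ x → A⁻¹ (A x) ≡ x)
  (BB⁻¹ : ∀ x → B (B⁻¹ x) ≡ x) (B⁻¹B : ∀ x → B⁻¹ (B x) ≡ x)
  (AB≡BA : ∀ x → A (B x) ≡ B (A x)) where

  private
    module A = IntegerPower A A⁻¹ AA⁻¹ A⁻¹A
    module B = IntegerPower B B⁻¹ BB⁻¹ B⁻¹B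

  t : ℤ → ℤ → X → X
  t m n x = A.pow m (B.pow n x)

  t-+ : ∀ a b c d x → t (a ℤ.+ c) (b ℤ.+ d) x ≡ t a b (t c d x)
  t-+ a b c d x = begin
    A.pow (a ℤ.+ c) (B.pow (b ℤ.+ d) x)          ≡⟨ A.pow-+ a c _ ⟩
    A.pow a (A.pow c (B.pow (b ℤ.+ d) x))        ≡⟨ cong (λ y → A.pow a (A.pow c y)) (B.pow-+ b d x) ⟩
    A.pow a (A.pow c (B.pow b (B.pow d x)))      ≡⟨ cong (A.pow a) (commute (B.pow d x)) ⟩
    A.pow a (B.pow b (A.pow c (B.pow d x)))      ∎
    where
    open ≡-Reasoning
    commute : ∀ y → A.pow c (B.pow b y) ≡ B.pow b (A.pow c y)
    commute = B.pow-commute (A.pow c) (λ y → sym (A.pow-commute B (λ z → sym (AB≡BA z)) c y)) b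

  t-cong : ∀ {a b c d} → a ≡ c → b ≡ d → ∀ x → t a b x ≡ t c d x
  t-cong refl refl x = refl

  t-neg : ∀ a b x → t (ℤ.- a) (ℤ.- b) (t a b x) ≡ x
  t-neg a b x = trans (sym (t-+ (ℤ.- a) (ℤ.- b) a b x)) (t-cong (ℤ.+-inverseˡ a) (ℤ.+-inverseˡ b) x)

  private
    pow-conj : (F G : X → X) (F∘G : ∀ x → F (G x) ≡ x) (G∘F : ∀ x → G (F x) ≡ x) →
      (h : X → X) (a b : ℤ) → (∀ x → h (F x) ≡ t a b (h x)) →
      ∀ m x → h (IntegerPower.pow F G F∘G G∘F m x) ≡ t (m ℤ.* a) (m ℤ.* b) (h x)
    pow-conj F G F∘G G∘F h a b hF = go
      where
      hG : ∀ x → h (G x) ≡ t (ℤ.- a) (ℤ.- b) (h x)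
      hG x = begin
        h (G x)                                    ≡⟨ sym (t-neg a b _) ⟩
        t (ℤ.- a) (ℤ.- b) (t a b (h (G x)))        ≡⟨ cong (t (ℤ.- a) (ℤ.- b)) (sym (hF (G x))) ⟩
        t (ℤ.- a) (ℤ.- b) (h (F (G x)))            ≡⟨ cong (λ y → t (ℤ.- a) (ℤ.- b) (h y)) (F∘G x) ⟩
        t (ℤ.- a) (ℤ.- b) (h x)                    ∎
        where open ≡-Reasoning
      go : ∀ m x → h (IntegerPower.pow F G F∘G G∘F m x) ≡ t (m ℤ.* a) (m ℤ.* b) (h x)
      go (+ zero) x = refl
      go (+ suc m) x = trans (hF _) (trans (cong (t a b) (go (+ m) x))
        (trans (sym (t-+ a b _ _ (h x))) (t-cong (sym (ℤ.suc-* (+ m) a)) (sym (ℤ.suc-* (+ m) b)) (h x))))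
      go -[1+ zero ] x = trans (hG x) (t-cong (sym (ℤ.-1*i≡-i a)) (sym (ℤ.-1*i≡-i b)) (h x))
      go -[1+ suc m ] x = trans (hG _) (trans (cong (t (ℤ.- a) (ℤ.- b)) (go -[1+ m ] x))
        (trans (sym (t-+ (ℤ.- a) (ℤ.- b) _ _ (h x))) (t-cong (pred-* -[1+ m ] a) (pred-* -[1+ m ] b) (h x))))
        where
        pred-* : ∀ i j → ℤ.- j ℤ.+ i ℤ.* j ≡ (-1ℤ ℤ.+ i) ℤ.* j
        pred-* = solve-∀

  -- Passing `h` across a translation is linear in the exponents: `(a , b)` and `(c , d)` are the
  -- rows of its matrix in the basis `A`, `B`.
  t-conj : (h : X → X) (a b c d : ℤ) →
    (∀ x → h (A x) ≡ t a b (h x)) → (∀ x → h (B x) ≡ t c d (h x)) →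
    ∀ m n x → h (t m n x) ≡ t (m ℤ.* a ℤ.+ n ℤ.* c) (m ℤ.* b ℤ.+ n ℤ.* d) (h x)
  t-conj h a b c d hA hB m n x = begin
    h (A.pow m (B.pow n x))                                    ≡⟨ pow-conj A A⁻¹ AA⁻¹ A⁻¹A h a b hA m (B.pow n x) ⟩
    t (m ℤ.* a) (m ℤ.* b) (h (B.pow n x))                      ≡⟨ cong (t (m ℤ.* a) (m ℤ.* b)) (pow-conj B B⁻¹ BB⁻¹ B⁻¹B h c d hB n x) ⟩
    t (m ℤ.* a) (m ℤ.* b) (t (n ℤ.* c) (n ℤ.* d) (h x))        ≡⟨ sym (t-+ (m ℤ.* a) (m ℤ.* b) (n ℤ.* c) (n ℤ.* d) (h x)) ⟩
    t (m ℤ.* a ℤ.+ n ℤ.* c) (m ℤ.* b ℤ.+ n ℤ.* d) (h x)        ∎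
    where open ≡-Reasoning

-- Orbits of a lattice acting on darts

fold-shift : ∀ {X : Set} (f : X → X) x n → fold (f x) f n ≡ f (fold x f n)
fold-shift f x zero    = refl
fold-shift f x (suc n) = cong f (fold-shift f x n)

fold-commute : ∀ {X Y : Set} (h : X → Y) (f : X → X) (g : Y → Y) → (∀ x → h (f x) ≡ g (h x)) →
  ∀ n x → h (fold x f n) ≡ fold (h x) g n
fold-commute h f g hf zero    x = refl
fold-commute h f g hf (suc n) x = trans (hf _) (cong g (fold-commute h f g hf n x))

fold-*-fold : ∀ {X : Set} (f : X → X) m n x → fold x f (m * n) ≡ fold x (λ y → fold y f n) m
fold-*-fold f zero    n x = refl
fold-*-fold f (suc m) n x = trans (fold-+ x f n) (cong (λ y → fold y f n) (fold-*-fold f m n x))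

Step : {X : Set} → (X → X) → (X → X) → X → X → Set
Step σ α x y = σ x ≡ y ⊎ α x ≡ y

record Automorphism {X : Set} (σ α : X → X) : Set where
  field
    to from  : X → X
    to-from  : ∀ x → to (from x) ≡ x
    from-to  : ∀ x → from (to x) ≡ x
    to-σ     : ∀ x → to (σ x) ≡ σ (to x)
    to-α     : ∀ x → to (α x) ≡ α (to x)

  from-σ : ∀ x → from (σ x) ≡ σ (from x)
  from-σ x = trans (cong (λ y → from (σ y)) (sym (to-from x)))
    (trans (cong from (sym (to-σ (from x)))) (from-to _))

  from-α : ∀ x → from (α x) ≡ α (from x)
  from-α x = trans (cong (λ y → from (α y)) (sym (to-from x)))
    (trans (cong from (sym (to-α (from x)))) (from-to _))

  inverse : Automorphism σ α
  inverse = record { to = from ; from = to ; to-from = from-to ; from-to = to-from ; to-σ = from-σ ; to-α = from-α }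

-- `σ` merely normalises the translations (`σ-t`). The geometric input is `free`: a rotation
-- agreeing with a translation at one dart is the identity. A half-turn takes `h` steps of `σ`, so
-- `h` counts the rotations modulo half-turns; `α-t` solves `A = half ∘ α` for `α`.
record LatticeAction {X : Set} (σ α : X → X) (h : ℕ) : Set₁ where
  half : X → X
  half x = fold x σ h
  field
    P       : Set
    t       : P → X → X
    0#      : P
    _∙_     : P → P → P
    -_      : P → P
    t-0#    : ∀ x → t 0# x ≡ x
    t-∙     : ∀ p q x → t (p ∙ q) x ≡ t p (t q x)
    t-neg   : ∀ p x → t (- p) (t p x) ≡ x
    t-comm  : ∀ p q x → t p (t q x) ≡ t q (t p x)
    σ-t     : ∀ p → ∃ λ q → ∀ x → σ (t p x) ≡ t q (σ x)
    half-t  : ∀ p x → half (t p x) ≡ t (- p) (half x)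
    half-involutive : ∀ x → half (half x) ≡ x
    a       : P
    α-t     : ∀ x → α x ≡ half (t a x)
    free    : ∀ i p x → fold x σ i ≡ t p x → ∀ y → fold y σ i ≡ y

  t-neg′ : ∀ p x → t p (t (- p) x) ≡ x
  t-neg′ p x = trans (t-comm p (- p) x) (t-neg p x)

  half-σ : ∀ x → half (σ x) ≡ σ (half x)
  half-σ x = fold-shift σ x h

  Reach : X → X → Set
  Reach x y = ∃₂ λ q k → y ≡ t q (fold x half k)

  halves-t : ∀ k p → ∃ λ q → ∀ x → fold (t p x) half k ≡ t q (fold x half k)
  halves-t zero    p = p , λ x → refl
  halves-t (suc k) p = let q , eq = halves-t k p in
    - q , λ x → trans (cong half (eq x)) (half-t q _)

  halves-involutive : ∀ k x → fold (fold x half k) half k ≡ x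
  halves-involutive zero    x = refl
  halves-involutive (suc k) x = trans (cong half (sym (fold-commute half half half (λ _ → refl) k (fold x half k))))
    (trans (half-involutive _) (halves-involutive k x))

  Reach-sym : ∀ {x y} → Reach x y → Reach y x
  Reach-sym {x} {y} (p , k , refl) = let q , eq = halves-t k p in
    - q , k , sym (trans (cong (t (- q)) (trans (eq _) (cong (t q) (halves-involutive k x)))) (t-neg q x))

  Reach-σ : ∀ {x y} → Reach x y → ∀ i → Reach (fold x σ i) (fold y σ i)
  Reach-σ r               zero    = r
  Reach-σ {x} {y} r (suc i) with Reach-σ r i
  ... | p , k , eq = let q , σt = σ-t p in q , k ,
    trans (cong σ eq) (trans (σt _) (cong (t q) (fold-commute σ half half (λ z → sym (half-σ z)) k _)))

  -- Translations commute, and a half-turn replaces `p` by `- p`, which fixes the same darts. A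
  -- smaller rotation could replace `p` by an unrelated translation.
  fixes-all : ∀ {x y} p → Reach x y → t p x ≡ x → t p y ≡ y
  fixes-all {x} p (q , k , refl) fix = trans (t-comm p q _) (cong (t q) (go k))
    where
    go : ∀ k → t p (fold x half k) ≡ fold x half k
    go zero    = fix
    go (suc k) = begin
      t p (half z)                  ≡⟨ cong (λ w → t p (half w)) (sym (go k)) ⟩
      t p (half (t p z))            ≡⟨ cong (t p) (half-t p z) ⟩
      t p (t (- p) (half z))        ≡⟨ t-neg′ p _ ⟩
      half z                        ∎
      where
      open ≡-Reasoning
      z = fold x half k

  same-t : ∀ {x y} p q → Reach x y → t p x ≡ t q x → t p y ≡ t q y
  same-t {x} {y} p q r eq = begin
    t p y                   ≡⟨ sym (t-neg′ q _) ⟩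
    t q (t (- q) (t p y))   ≡⟨ cong (t q) (sym (t-∙ (- q) p y)) ⟩
    t q (t ((- q) ∙ p) y)   ≡⟨ cong (t q) (fixes-all ((- q) ∙ p) r (trans (t-∙ (- q) p x) (trans (cong (t (- q)) eq) (t-neg q x)))) ⟩
    t q y                   ∎
    where open ≡-Reasoning

  private
    coordinates-unique-≤ : ∀ {x y} p q i k → Reach x y →
      t p (fold x σ i) ≡ t q (fold x σ (k + i)) → t p (fold y σ i) ≡ t q (fold y σ (k + i))
    coordinates-unique-≤ {x} {y} p q i k r eq = trans
      (same-t p q (Reach-σ r i) (trans eq (cong (t q) (rotate x)))) (cong (t q) (sym (rotate y)))
      where
      open ≡-Reasoning
      z = fold x σ i
      translated : fold z σ k ≡ t ((- q) ∙ p) z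
      translated = begin
        fold z σ k                      ≡⟨ sym (t-neg q _) ⟩
        t (- q) (t q (fold z σ k))      ≡⟨ cong (λ w → t (- q) (t q w)) (sym (fold-+ x σ k)) ⟩
        t (- q) (t q (fold x σ (k + i)))   ≡⟨ cong (t (- q)) (sym eq) ⟩
        t (- q) (t p z)                 ≡⟨ sym (t-∙ (- q) p z) ⟩
        t ((- q) ∙ p) z                 ∎
      rotate : ∀ w → fold w σ (k + i) ≡ fold w σ i
      rotate w = trans (fold-+ w σ k) (free k _ z translated _)

  -- Two names of one dart differ by a rotation that agrees with a translation at a dart; `free`
  -- makes this rotation trivial, and `same-t` compares the translations that remain. Exponents of
  -- `σ` are natural numbers, hence the reduction to the case where one is the smaller.
  coordinates-unique : ∀ {x y} p q i j → Reach x y →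
    t p (fold x σ i) ≡ t q (fold x σ j) → t p (fold y σ i) ≡ t q (fold y σ j)
  coordinates-unique {x} {y} p q i j r eq with ℕ.≤-total i j
  ... | inj₁ i≤j with k , refl ← ℕ.m≤n⇒∃[o]m+o≡n i≤j rewrite ℕ.+-comm i k =
    coordinates-unique-≤ p q i k r eq
  ... | inj₂ j≤i with k , refl ← ℕ.m≤n⇒∃[o]m+o≡n j≤i rewrite ℕ.+-comm j k =
    sym (coordinates-unique-≤ q p j k r (sym eq))

  Coordinates : X → X → Set
  Coordinates o x = ∃₂ λ p i → x ≡ t p (fold o σ i)

  coordinates-σ : ∀ {o} x → Coordinates o x → Coordinates o (σ x)
  coordinates-σ x (p , i , eq) = let q , σt = σ-t p in q , suc i , trans (cong σ eq) (σt _)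

  α-coordinates : ∀ p x i → α (t p (fold x σ i)) ≡ t (- (a ∙ p)) (fold x σ (h + i))
  α-coordinates p x i = begin
    α (t p (fold x σ i))               ≡⟨ α-t _ ⟩
    half (t a (t p (fold x σ i)))      ≡⟨ cong half (sym (t-∙ a p _)) ⟩
    half (t (a ∙ p) (fold x σ i))      ≡⟨ half-t _ _ ⟩
    t (- (a ∙ p)) (half (fold x σ i))  ≡⟨ cong (t (- (a ∙ p))) (sym (fold-+ x σ h)) ⟩
    t (- (a ∙ p)) (fold x σ (h + i))   ∎
    where open ≡-Reasoning

  module _ (connected : ∀ x y → Star (Step σ α) x y) where

    coordinates : ∀ o x → Coordinates o x
    coordinates o x = go (0# , 0 , sym (t-0# o)) (connected o x)
      where
      go : ∀ {x y} → Coordinates o x → Star (Step σ α) x y → Coordinates o y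
      go c ε = c
      go c (inj₁ refl ◅ xs) = go (coordinates-σ _ c) xs
      go (p , i , refl) (inj₂ refl ◅ xs) = go (- (a ∙ p) , h + i , α-coordinates p o i) xs

    -- The candidate automorphism moves x to y and keeps coordinates; it is
    -- well defined because the stabilisers consist of translations only.
    transport : X → X → X → X
    transport x y z = let p , i , _ = coordinates x z in t p (fold y σ i)

    transport-unique : ∀ {x y} → Reach x y → ∀ {z} p i → z ≡ t p (fold x σ i) →
      transport x y z ≡ t p (fold y σ i)
    transport-unique {x} r {z} p i eq = let q , j , eq′ = coordinates x z in
      coordinates-unique q p j i r (trans (sym eq′) eq)

    transport-base : ∀ {x y} → Reach x y → transport x y x ≡ y
    transport-base {x} {y} r = trans (transport-unique r 0# 0 (sym (t-0# x))) (t-0# y)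

    transport-σ : ∀ {x y} → Reach x y → ∀ z → transport x y (σ z) ≡ σ (transport x y z)
    transport-σ {x} r z = let p , i , eq = coordinates x z ; q , σt = σ-t p in
      trans (transport-unique r q (suc i) (trans (cong σ eq) (σt _))) (sym (σt _))

    transport-α : ∀ {x y} → Reach x y → ∀ z → transport x y (α z) ≡ α (transport x y z)
    transport-α {x} {y} r z = let p , i , eq = coordinates x z in
      trans (transport-unique r (- (a ∙ p)) (h + i) (trans (cong α eq) (α-coordinates p x i)))
        (sym (α-coordinates p y i))

    -- The composite commutes with `σ` and `α` and fixes `x`, so it fixes every dart on a path from
    -- `x`.
    transport-inverse : ∀ {x y} → Reach x y → ∀ z → transport y x (transport x y z) ≡ z
    transport-inverse {x} {y} r z = go (trans (cong (transport y x) (transport-base r)) (transport-base r′)) (connected x z)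
      where
      r′ = Reach-sym r
      go : ∀ {u v} → transport y x (transport x y u) ≡ u → Star (Step σ α) u v →
        transport y x (transport x y v) ≡ v
      go eq ε = eq
      go eq (inj₁ refl ◅ xs) = go (trans (cong (transport y x) (transport-σ r _)) (trans (transport-σ r′ _) (cong σ eq))) xs
      go eq (inj₂ refl ◅ xs) = go (trans (cong (transport y x) (transport-α r _)) (trans (transport-α r′ _) (cong α eq))) xs

    reach⇒automorphism : ∀ {x y} → Reach x y → ∃ λ (θ : Automorphism σ α) → Automorphism.to θ x ≡ y
    reach⇒automorphism {x} {y} r = record
      { to = transport x y ; from = transport y x
      ; to-from = transport-inverse (Reach-sym r) ; from-to = transport-inverse r
      ; to-σ = transport-σ r ; to-α = transport-α r } , transport-base r

    reach-from-rotation : .{{_ : ℕ.NonZero h}} → ∀ o x → ∃ λ (c : Fin h) → Reach (fold o σ (toℕ c)) x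
    reach-from-rotation o x = let p , i , eq = coordinates o x in
      i mod h , p , i / h , trans eq (cong (t p) (decompose i))
      where
      open ≡-Reasoning
      decompose : ∀ i → fold o σ i ≡ fold (fold o σ (toℕ (i mod h))) half (i / h)
      decompose i = begin
        fold o σ i                                        ≡⟨ cong (fold o σ) (trans (m≡m%n+[m/n]*n i h) (ℕ.+-comm (i % h) _)) ⟩
        fold o σ (i / h * h + i % h)                      ≡⟨ fold-+ o σ (i / h * h) ⟩
        fold (fold o σ (i % h)) σ (i / h * h)             ≡⟨ fold-*-fold σ (i / h) h _ ⟩
        fold (fold o σ (i % h)) half (i / h)              ≡⟨ cong (λ c → fold (fold o σ c) half (i / h)) (sym (Fin.toℕ-fromℕ< (m%n<n i h))) ⟩
        fold (fold o σ (toℕ (i mod h))) half (i / h)      ∎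

    orbits : .{{_ : ℕ.NonZero h}} → ∀ o x → ∃₂ λ (c : Fin h) (θ : Automorphism σ α) →
      Automorphism.to θ (fold o σ (toℕ c)) ≡ x
    orbits o x = let c , r = reach-from-rotation o x in c , reach⇒automorphism r

-- Triangulations and quadrangulations

order-multiple : ∀ {X : Set} (f : X → X) n {x} → fold x f n ≡ x → ∀ k → fold x f (k * n) ≡ x
order-multiple f n         order zero    = refl
order-multiple f n {x} order (suc k) = trans (fold-+ x f n)
  (trans (cong (λ y → fold y f n) (order-multiple f n order k)) order)

order-mod : ∀ {X : Set} (f : X → X) n .{{_ : ℕ.NonZero n}} {x} → fold x f n ≡ x →
  ∀ i → fold x f i ≡ fold x f (i % n)
order-mod f n {x} order i = trans (cong (fold x f) (m≡m%n+[m/n]*n i n))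
  (trans (fold-+ x f (i % n)) (cong (λ y → fold y f (i % n)) (order-multiple f n order (i / n))))

_⊞_ : ℤ × ℤ → ℤ × ℤ → ℤ × ℤ
(a , b) ⊞ (c , d) = a ℤ.+ c , b ℤ.+ d

-- Since `σ` normalises the translations, agreement of a rotation with a translation at one dart
-- passes to its positive powers; it is then enough to exclude a few rotations.
powers-translate : ∀ {X P : Set} (σ : X → X) (t : P → X → X) (_∙_ : P → P → P) →
  (∀ p q x → t (p ∙ q) x ≡ t p (t q x)) → (∀ p → ∃ λ q → ∀ x → σ (t p x) ≡ t q (σ x)) →
  ∀ i p x → fold x σ i ≡ t p x → ∀ k → ∃ λ q → fold x σ (suc k * i) ≡ t q x
powers-translate σ t _∙_ t-∙ σ-t i p x eq zero = p , trans (cong (fold x σ) (ℕ.+-identityʳ i)) eq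
powers-translate σ t _∙_ t-∙ σ-t i p x eq (suc k) =
  let q , eq′ = powers-translate σ t _∙_ t-∙ σ-t i p x eq k
      r , σⁱt = conj i q
  in r ∙ p , (begin
    fold x σ (i + suc k * i)         ≡⟨ fold-+ x σ i ⟩
    fold (fold x σ (suc k * i)) σ i  ≡⟨ cong (λ y → fold y σ i) eq′ ⟩
    fold (t q x) σ i                 ≡⟨ σⁱt x ⟩
    t r (fold x σ i)                 ≡⟨ cong (t r) eq ⟩
    t r (t p x)                      ≡⟨ sym (t-∙ r p x) ⟩
    t (r ∙ p) x                      ∎)
  where
  open ≡-Reasoning
  conj : ∀ i p → ∃ λ q → ∀ x → fold (t p x) σ i ≡ t q (fold x σ i)
  conj zero    p = p , λ _ → refl
  conj (suc i) p = let q , eq = conj i p ; r , σt = σ-t q in r , λ x → trans (cong σ (eq x)) (σt _)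

parity : ∀ m → ∃₂ λ k r → r < 2 × m ℤ.- k ℤ.- k ≡ + r
parity m = m /ℕ 2 , m %ℕ 2 , n%ℕd<d m 2 ,
  trans (cong (λ z → z ℤ.- m /ℕ 2 ℤ.- m /ℕ 2) (a≡a%ℕn+[a/ℕn]*n m 2)) (lemma (+ (m %ℕ 2)) (m /ℕ 2))
  where
  lemma : ∀ r q → (r ℤ.+ q ℤ.* + 2) ℤ.- q ℤ.- q ≡ r
  lemma = solve-∀

-- Residues -1, 0, 1 leave only the translations `A⁻¹`, identity and `A` in `σ²≢t`, each tied to one
-- kind of centre.
balanced-mod-3 : ∀ m → ∃₂ λ k r → r < 3 × m ℤ.- (+ 3 ℤ.* k) ≡ + r ℤ.- 1ℤ
balanced-mod-3 m = m′ /ℕ 3 , m′ %ℕ 3 , n%ℕd<d m′ 3 , trans (first m (m′ /ℕ 3))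
  (trans (cong (λ z → z ℤ.- 1ℤ ℤ.- (+ 3 ℤ.* (m′ /ℕ 3))) (a≡a%ℕn+[a/ℕn]*n m′ 3)) (lemma (+ (m′ %ℕ 3)) (m′ /ℕ 3)))
  where
  m′ = m ℤ.+ 1ℤ
  first : ∀ m k → m ℤ.- (+ 3 ℤ.* k) ≡ (m ℤ.+ 1ℤ) ℤ.- 1ℤ ℤ.- (+ 3 ℤ.* k)
  first = solve-∀
  lemma : ∀ r q → (r ℤ.+ q ℤ.* + 3) ℤ.- 1ℤ ℤ.- (+ 3 ℤ.* q) ≡ r ℤ.- 1ℤ
  lemma = solve-∀

record Triangular {X : Set} (σ α : X → X) : Set where
  field
    σ⁶ : ∀ x → fold x σ 6 ≡ x
    α² : ∀ x → α (α x) ≡ x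
    [σα]³ : ∀ x → σ (α (σ (α (σ (α x))))) ≡ x
    σ²-free : ∀ x → σ (σ x) ≢ x
    σ³-free : ∀ x → σ (σ (σ x)) ≢ x
    α-free  : ∀ x → α x ≢ x
    σα-free : ∀ x → σ (α x) ≢ x

module _ {X : Set} {σ α : X → X} (T : Triangular σ α) where
  open Triangular T

  private
    A A⁻¹ B B⁻¹ σ² σ³ σ⁵ : X → X
    σ² x = σ (σ x)
    σ³ x = σ (σ² x)
    σ⁵ x = σ² (σ³ x)
    A   x = σ³ (α x)
    A⁻¹ x = α (σ³ x)
    B   x = σ (σ³ (α (σ⁵ x)))
    B⁻¹ x = σ (α (σ² x))

    σ-injective : ∀ {x y} → σ x ≡ σ y → x ≡ y
    σ-injective eq = trans (sym (σ⁶ _)) (trans (cong σ⁵ eq) (σ⁶ _))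

    -- The triangle relation `(σα)³ = 1`, with `σ⁵` as the inverse of `σ`, turned into a rewriting
    -- rule.
    ασα : ∀ x → α (σ (α x)) ≡ σ⁵ (α (σ⁵ x))
    ασα x = σ-injective (begin
      σ (α (σ (α x)))                       ≡⟨ cong (λ y → σ (α (σ (α y)))) (sym (σ⁶ x)) ⟩
      σ (α (σ (α (σ (σ⁵ x)))))              ≡⟨ cong (λ y → σ (α (σ (α (σ y))))) (sym (α² (σ⁵ x))) ⟩
      σ (α (σ (α (σ (α (α (σ⁵ x)))))))      ≡⟨ [σα]³ _ ⟩
      α (σ⁵ x)                              ≡⟨ sym (σ⁶ _) ⟩
      σ (σ⁵ (α (σ⁵ x)))                     ∎)
      where open ≡-Reasoning

    AB≡BA : ∀ x → A (B x) ≡ B (A x)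
    AB≡BA x = cong σ³ (begin
      α (σ² (σ² (α (σ⁵ x))))                ≡⟨ sym (σ⁶ _) ⟩
      σ (σ⁵ (α (σ² (σ² (α (σ⁵ x))))))       ≡⟨ cong (λ y → σ (σ⁵ (α y))) (sym (σ⁶ _)) ⟩
      σ (σ⁵ (α (σ⁵ (σ⁵ (α (σ⁵ x))))))       ≡⟨ cong (λ y → σ (σ⁵ (α (σ⁵ y)))) (sym (ασα x)) ⟩
      σ (σ⁵ (α (σ⁵ (α (σ (α x))))))         ≡⟨ cong σ (sym (ασα _)) ⟩
      σ (α (σ (α (α (σ (α x))))))           ≡⟨ cong (λ y → σ (α (σ y))) (α² _) ⟩
      σ (α (σ² (α x)))                      ≡⟨ cong (λ y → σ (α y)) (sym (σ⁶ _)) ⟩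
      σ (α (σ⁵ (σ³ (α x))))                 ∎)
      where open ≡-Reasoning

    open Translations A A⁻¹ B B⁻¹
      (λ x → trans (cong σ³ (α² _)) (σ⁶ x)) (λ x → trans (cong α (σ⁶ _)) (α² x))
      (λ x → trans (cong (λ y → σ (σ³ (α y))) (σ⁶ _)) (trans (cong (λ y → σ (σ³ y)) (α² _)) (σ⁶ x)))
      (λ x → trans (cong (λ y → σ (α y)) (σ⁶ _)) (trans (cong σ (α² _)) (σ⁶ x))) AB≡BA

    -- A sixth of a turn takes `A` to `B` and `B` to `A⁻¹B`, like multiplication by a primitive
    -- sixth root of unity on the Eisenstein integers.
    σ-t : ∀ m n x → σ (t m n x) ≡ t (ℤ.- n) (m ℤ.+ n) (σ x)
    σ-t m n x = trans (t-conj σ 0ℤ 1ℤ -1ℤ 1ℤ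
      (λ y → cong (λ z → σ (σ³ (α z))) (sym (σ⁶ y)))
      (λ y → trans (sym (ασα y)) (trans (cong (λ z → α (σ (α z))) (sym (σ⁶ y))) (cong α (sym (σ⁶ _))))) m n x)
      (t-cong (first m n) (second m n) (σ x))
      where
      first : ∀ m n → m ℤ.* 0ℤ ℤ.+ n ℤ.* -1ℤ ≡ ℤ.- n
      first = solve-∀
      second : ∀ m n → m ℤ.* 1ℤ ℤ.+ n ℤ.* 1ℤ ≡ m ℤ.+ n
      second = solve-∀

    σ²-t : ∀ m n x → σ² (t m n x) ≡ t (ℤ.- (m ℤ.+ n)) m (σ² x)
    σ²-t m n x = trans (cong σ (σ-t m n x)) (trans (σ-t (ℤ.- n) (m ℤ.+ n) (σ x))
      (t-cong {ℤ.- (m ℤ.+ n)} refl (second m n) (σ² x)))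
      where
      second : ∀ m n → ℤ.- n ℤ.+ (m ℤ.+ n) ≡ m
      second = solve-∀

    σ³-t : ∀ m n x → σ³ (t m n x) ≡ t (ℤ.- m) (ℤ.- n) (σ³ x)
    σ³-t m n x = trans (cong σ (σ²-t m n x)) (trans (σ-t (ℤ.- (m ℤ.+ n)) m (σ² x))
      (t-cong {ℤ.- m} refl (second m n) (σ³ x)))
      where
      second : ∀ m n → ℤ.- (m ℤ.+ n) ℤ.+ m ≡ ℤ.- n
      second = solve-∀

    -- A half-turn combined with a translation is a half-turn about another
    -- vertex or about the midpoint of an edge, hence fixes no dart.
    σ³≢t : ∀ m n x → σ³ x ≢ t m n x
    σ³≢t m n x eq with k , r , r<2 , m≡ ← parity m | l , s , s<2 , n≡ ← parity n = cases r s r<2 s<2 shifted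
      where
      open ≡-Reasoning
      y = t k l x
      ring : ∀ a b → ℤ.- a ℤ.+ b ≡ (b ℤ.- a ℤ.- a) ℤ.+ a
      ring = solve-∀
      -- Moving the dart by `t k l` lowers `m` and `n` by `2k` and `2l`, so only their parities
      -- survive: four classes of centres.
      shifted : σ³ y ≡ t (+ r) (+ s) y
      shifted = begin
        σ³ (t k l x)                                  ≡⟨ σ³-t k l x ⟩
        t (ℤ.- k) (ℤ.- l) (σ³ x)                      ≡⟨ cong (t (ℤ.- k) (ℤ.- l)) eq ⟩
        t (ℤ.- k) (ℤ.- l) (t m n x)                   ≡⟨ sym (t-+ (ℤ.- k) (ℤ.- l) m n x) ⟩
        t (ℤ.- k ℤ.+ m) (ℤ.- l ℤ.+ n) x               ≡⟨ t-cong (trans (ring k m) (cong (ℤ._+ k) m≡)) (trans (ring l n) (cong (ℤ._+ l) n≡)) x ⟩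
        t (+ r ℤ.+ k) (+ s ℤ.+ l) x                   ≡⟨ t-+ (+ r) (+ s) k l x ⟩
        t (+ r) (+ s) y                               ∎
      cases : ∀ r s → r < 2 → s < 2 → ∀ {y} → σ³ y ≡ t (+ r) (+ s) y → ⊥
      cases 0 0 _ _ eq = σ³-free _ eq
      cases 1 0 _ _ eq = α-free _ (sym (σ-injective (σ-injective (σ-injective eq))))
      cases 0 1 _ _ {y} eq = α-free (σ⁵ y) (σ-injective (σ-injective (σ-injective (σ-injective (trans (sym eq)
        (cong σ³ (sym (σ⁶ y))))))))
      -- `AB` is the long diagonal of a rhombus whose short diagonal is an edge. They share their
      -- midpoint, so `α` would fix the dart `σ² (σ² w)` along the short one.
      cases 1 1 _ _ {y} eq = α-free (σ² (σ² w)) (σ-injective (σ-injective (σ-injective (σ-injective (σ-injective (begin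
        σ⁵ (α (σ² (σ² w)))               ≡⟨ cong (λ z → σ⁵ (α z)) (sym (σ⁶ _)) ⟩
        σ⁵ (α (σ⁵ (σ⁵ w)))               ≡⟨ sym (ασα _) ⟩
        α (σ (α (σ⁵ w)))                 ≡⟨ cong α (sym (σ⁶ _)) ⟩
        A⁻¹ (B w)                    ≡⟨ cong A⁻¹ (sym (AB≡BA y)) ⟩
        A⁻¹ (A (B y))                    ≡⟨ trans (cong α (σ⁶ _)) (α² _) ⟩
        B y                              ≡⟨ trans (sym (trans (cong α (σ⁶ _)) (α² _))) (cong A⁻¹ (sym eq)) ⟩
        A⁻¹ (σ³ y)                    ≡⟨ cong α (σ⁶ y) ⟩
        α y                              ≡⟨ sym (σ⁶ _) ⟩
        σ³ w                             ≡⟨ sym (σ⁶ _) ⟩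
        σ⁵ (σ² (σ² w))                   ∎))))))
        where
        w = A y
      cases (suc (suc _)) _ (s≤s (s≤s ())) _ _
      cases _ (suc (suc _)) _ (s≤s (s≤s ())) _

    -- Likewise for a third of a turn, whose centres are vertices and faces.
    σ²≢t : ∀ m n x → σ² x ≢ t m n x
    σ²≢t m n x eq with k , r , r<3 , m≡ ← balanced-mod-3 (m ℤ.- n) = cases r r<3 shifted
      where
      open ≡-Reasoning
      -- Moving the dart does not change `m - n` modulo 3. The second entry `n + k` makes the second
      -- exponent vanish, and `k` then reduces the first.
      y = t k (n ℤ.+ k) x
      first : ∀ m n k → ℤ.- (k ℤ.+ (n ℤ.+ k)) ℤ.+ m ≡ ((m ℤ.- n) ℤ.- (+ 3 ℤ.* k)) ℤ.+ k
      first = solve-∀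
      second : ∀ n k → k ℤ.+ n ≡ 0ℤ ℤ.+ (n ℤ.+ k)
      second = solve-∀
      shifted : σ² y ≡ t (+ r ℤ.- 1ℤ) 0ℤ y
      shifted = begin
        σ² y                                                 ≡⟨ σ²-t k (n ℤ.+ k) x ⟩
        t (ℤ.- (k ℤ.+ (n ℤ.+ k))) k (σ² x)                   ≡⟨ cong (t (ℤ.- (k ℤ.+ (n ℤ.+ k))) k) eq ⟩
        t (ℤ.- (k ℤ.+ (n ℤ.+ k))) k (t m n x)                ≡⟨ sym (t-+ (ℤ.- (k ℤ.+ (n ℤ.+ k))) k m n x) ⟩
        t (ℤ.- (k ℤ.+ (n ℤ.+ k)) ℤ.+ m) (k ℤ.+ n) x          ≡⟨ t-cong (trans (first m n k) (cong (ℤ._+ k) m≡)) (second n k) x ⟩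
        t (+ r ℤ.- 1ℤ ℤ.+ k) (0ℤ ℤ.+ (n ℤ.+ k)) x            ≡⟨ t-+ (+ r ℤ.- 1ℤ) 0ℤ k (n ℤ.+ k) x ⟩
        t (+ r ℤ.- 1ℤ) 0ℤ y                                  ∎
      cases : ∀ r → r < 3 → ∀ {y} → σ² y ≡ t (+ r ℤ.- 1ℤ) 0ℤ y → ⊥
      cases 0 _ {y} eq = σα-free (α (σ² y)) (begin
        σ (α (α (σ² y)))      ≡⟨ cong σ (α² _) ⟩
        σ³ y                  ≡⟨ sym (α² _) ⟩
        α (α (σ³ y))          ≡⟨ cong α (sym eq) ⟩
        α (σ² y)              ∎)
      cases 1 _ eq = σ²-free _ eq
      cases 2 _ {y} eq = σα-free y (sym (σ-injective (σ-injective eq)))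
      cases (suc (suc (suc _))) (s≤s (s≤s (s≤s ()))) _

    free : ∀ i m n x → fold x σ i ≡ t m n x → ∀ y → fold y σ i ≡ y
    free i m n x eq y = trans (order-mod σ 6 (σ⁶ y) i)
      (cases (i % 6) (m%n<n i 6) (trans (sym (order-mod σ 6 (σ⁶ x) i)) eq))
      where
      -- Each `r` below 6 other than 0 and 3 has a multiple congruent to 2 modulo 6; `k` is one less
      -- than the multiplier.
      by-σ² : ∀ r k → suc k * r % 6 ≡ 2 → fold x σ r ≢ t m n x
      by-σ² r k kr≡2 eq =
        let (a , b) , eq′ = powers-translate σ (λ (a , b) → t a b) _⊞_ (λ (a , b) (c , d) → t-+ a b c d)
              (λ (a , b) → (ℤ.- b , a ℤ.+ b) , σ-t a b) r (m , n) x eq k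
        in σ²≢t a b x (trans (trans (cong (fold x σ) (sym kr≡2)) (sym (order-mod σ 6 (σ⁶ x) (suc k * r)))) eq′)
      cases : ∀ r → r < 6 → fold x σ r ≡ t m n x → fold y σ r ≡ y
      cases 0 _ _ = refl
      cases 1 _ eq = contradiction eq (by-σ² 1 1 refl)
      cases 2 _ eq = contradiction eq (by-σ² 2 0 refl)
      cases 3 _ eq = contradiction eq (σ³≢t m n x)
      cases 4 _ eq = contradiction eq (by-σ² 4 1 refl)
      cases 5 _ eq = contradiction eq (by-σ² 5 3 refl)
      cases (suc (suc (suc (suc (suc (suc _)))))) (s≤s (s≤s (s≤s (s≤s (s≤s (s≤s ())))))) _

  triangularAction : LatticeAction σ α 3
  triangularAction = record
    { P = ℤ × ℤ
    ; t = λ (m , n) → t m n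
    ; 0# = 0ℤ , 0ℤ
    ; _∙_ = _⊞_
    ; -_ = λ (m , n) → ℤ.- m , ℤ.- n
    ; t-0# = λ _ → refl
    ; t-∙ = λ (a , b) (c , d) → t-+ a b c d
    ; t-neg = λ (m , n) → t-neg m n
    ; t-comm = λ (a , b) (c , d) x → trans (sym (t-+ a b c d x))
        (trans (t-cong (ℤ.+-comm a c) (ℤ.+-comm b d) x) (t-+ c d a b x))
    ; σ-t = λ (m , n) → (ℤ.- n , m ℤ.+ n) , σ-t m n
    ; half-t = λ (m , n) → σ³-t m n
    ; half-involutive = σ⁶
    ; a = 1ℤ , 0ℤ
    ; α-t = λ x → sym (σ⁶ _)
    ; free = λ i (m , n) → free i m n
    }

record Quadrangular {X : Set} (σ α : X → X) : Set where
  field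
    σ⁴ : ∀ x → fold x σ 4 ≡ x
    α² : ∀ x → α (α x) ≡ x
    [σα]⁴ : ∀ x → σ (α (σ (α (σ (α (σ (α x))))))) ≡ x
    σ²-free : ∀ x → σ (σ x) ≢ x
    α-free  : ∀ x → α x ≢ x
    [σα]²-free : ∀ x → σ (α (σ (α x))) ≢ x

module _ {X : Set} {σ α : X → X} (Q : Quadrangular σ α) where
  open Quadrangular Q

  private
    A A⁻¹ B B⁻¹ σ² σ³ : X → X
    σ² x = σ (σ x)
    σ³ x = σ (σ² x)
    A   x = σ² (α x)
    A⁻¹ x = α (σ² x)
    B   x = σ³ (α (σ³ x))
    B⁻¹ x = σ (α (σ x))

    σ-injective : ∀ {x y} → σ x ≡ σ y → x ≡ y
    σ-injective eq = trans (sym (σ⁴ _)) (trans (cong σ³ eq) (σ⁴ _))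

    -- By `(σα)⁴ = 1`, `(σα)²` equals its own inverse, which is `(ασ³)²`.
    ασ³ασ³ : ∀ x → α (σ³ (α (σ³ x))) ≡ σ (α (σ (α x)))
    ασ³ασ³ x = begin
      α (σ³ (α (σ³ x)))                                  ≡⟨ cong (λ y → α (σ³ (α (σ³ y)))) (sym ([σα]⁴ x)) ⟩
      α (σ³ (α (σ³ (σ (α (σ (α y)))))))                  ≡⟨ cong (λ z → α (σ³ (α z))) (σ⁴ _) ⟩
      α (σ³ (α (α (σ (α y)))))                           ≡⟨ cong (λ z → α (σ³ z)) (α² _) ⟩
      α (σ³ (σ (α y)))                                   ≡⟨ cong α (σ⁴ _) ⟩
      α (α y)                                            ≡⟨ α² y ⟩
      y                                                  ∎
      where
      open ≡-Reasoning
      y = σ (α (σ (α x)))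

    AB≡BA : ∀ x → A (B x) ≡ B (A x)
    AB≡BA x = begin
      σ² (α (σ³ (α (σ³ x))))       ≡⟨ cong σ² (ασ³ασ³ x) ⟩
      σ³ (α (σ (α x)))             ≡⟨ cong (λ y → σ³ (α y)) (sym (σ⁴ _)) ⟩
      σ³ (α (σ³ (σ² (α x))))       ∎
      where open ≡-Reasoning

    open Translations A A⁻¹ B B⁻¹
      (λ x → trans (cong σ² (α² _)) (σ⁴ x)) (λ x → trans (cong α (σ⁴ _)) (α² x))
      (λ x → trans (cong (λ y → σ³ (α y)) (σ⁴ _)) (trans (cong σ³ (α² _)) (σ⁴ x)))
      (λ x → trans (cong (λ y → σ (α y)) (σ⁴ _)) (trans (cong σ (α² _)) (σ⁴ x))) AB≡BA

    -- A quarter turn takes `A` to `B` and `B` to `A⁻¹`, like multiplication by i on the Gaussian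
    -- integers.
    σ-t : ∀ m n x → σ (t m n x) ≡ t (ℤ.- n) m (σ x)
    σ-t m n x = trans (t-conj σ 0ℤ 1ℤ -1ℤ 0ℤ
      (λ y → cong (λ z → σ³ (α z)) (sym (σ⁴ y)))
      (λ y → σ⁴ _) m n x) (t-cong (first m n) (second m n) (σ x))
      where
      first : ∀ m n → m ℤ.* 0ℤ ℤ.+ n ℤ.* -1ℤ ≡ ℤ.- n
      first = solve-∀
      second : ∀ m n → m ℤ.* 1ℤ ℤ.+ n ℤ.* 0ℤ ≡ m
      second = solve-∀

    σ²-t : ∀ m n x → σ² (t m n x) ≡ t (ℤ.- m) (ℤ.- n) (σ² x)
    σ²-t m n x = trans (cong σ (σ-t m n x)) (σ-t (ℤ.- n) m (σ x))

    -- The centres of these half-turns are vertices, edges and faces.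
    σ²≢t : ∀ m n x → σ² x ≢ t m n x
    σ²≢t m n x eq with k , r , r<2 , m≡ ← parity m | l , s , s<2 , n≡ ← parity n = cases r s r<2 s<2 shifted
      where
      open ≡-Reasoning
      y = t k l x
      ring : ∀ a b → ℤ.- a ℤ.+ b ≡ (b ℤ.- a ℤ.- a) ℤ.+ a
      ring = solve-∀
      shifted : σ² y ≡ t (+ r) (+ s) y
      shifted = begin
        σ² (t k l x)                                  ≡⟨ σ²-t k l x ⟩
        t (ℤ.- k) (ℤ.- l) (σ² x)                      ≡⟨ cong (t (ℤ.- k) (ℤ.- l)) eq ⟩
        t (ℤ.- k) (ℤ.- l) (t m n x)                   ≡⟨ sym (t-+ (ℤ.- k) (ℤ.- l) m n x) ⟩
        t (ℤ.- k ℤ.+ m) (ℤ.- l ℤ.+ n) x               ≡⟨ t-cong (trans (ring k m) (cong (ℤ._+ k) m≡)) (trans (ring l n) (cong (ℤ._+ l) n≡)) x ⟩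
        t (+ r ℤ.+ k) (+ s ℤ.+ l) x                   ≡⟨ t-+ (+ r) (+ s) k l x ⟩
        t (+ r) (+ s) y                               ∎
      cases : ∀ r s → r < 2 → s < 2 → ∀ {y} → σ² y ≡ t (+ r) (+ s) y → ⊥
      cases 0 0 _ _ eq = σ²-free _ eq
      cases 1 0 _ _ eq = α-free _ (sym (σ-injective (σ-injective eq)))
      cases 0 1 _ _ {y} eq = α-free (σ³ y) (σ-injective (σ-injective (σ-injective (trans (sym eq)
        (cong σ² (sym (σ⁴ y)))))))
      -- The midpoint of the diagonal `AB` is the centre of a face, about which `(σα)²` is the
      -- half-turn.
      cases 1 1 _ _ {y} eq = [σα]²-free y (sym (trans (σ-injective (σ-injective eq)) (ασ³ασ³ y)))
      cases (suc (suc _)) _ (s≤s (s≤s ())) _ _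
      cases _ (suc (suc _)) _ (s≤s (s≤s ())) _

    free : ∀ i m n x → fold x σ i ≡ t m n x → ∀ y → fold y σ i ≡ y
    free i m n x eq y = trans (order-mod σ 4 (σ⁴ y) i)
      (cases (i % 4) (m%n<n i 4) (trans (sym (order-mod σ 4 (σ⁴ x) i)) eq))
      where
      by-σ² : ∀ r k → suc k * r % 4 ≡ 2 → fold x σ r ≢ t m n x
      by-σ² r k kr≡2 eq =
        let (a , b) , eq′ = powers-translate σ (λ (a , b) → t a b) _⊞_ (λ (a , b) (c , d) → t-+ a b c d)
              (λ (a , b) → (ℤ.- b , a) , σ-t a b) r (m , n) x eq k
        in σ²≢t a b x (trans (trans (cong (fold x σ) (sym kr≡2)) (sym (order-mod σ 4 (σ⁴ x) (suc k * r)))) eq′)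
      cases : ∀ r → r < 4 → fold x σ r ≡ t m n x → fold y σ r ≡ y
      cases 0 _ _ = refl
      cases 1 _ eq = contradiction eq (by-σ² 1 1 refl)
      cases 2 _ eq = contradiction eq (by-σ² 2 0 refl)
      cases 3 _ eq = contradiction eq (by-σ² 3 1 refl)
      cases (suc (suc (suc (suc _)))) (s≤s (s≤s (s≤s (s≤s ())))) _

  quadrangularAction : LatticeAction σ α 2
  quadrangularAction = record
    { P = ℤ × ℤ
    ; t = λ (m , n) → t m n
    ; 0# = 0ℤ , 0ℤ
    ; _∙_ = _⊞_
    ; -_ = λ (m , n) → ℤ.- m , ℤ.- n
    ; t-0# = λ _ → refl
    ; t-∙ = λ (a , b) (c , d) → t-+ a b c d
    ; t-neg = λ (m , n) → t-neg m n
    ; t-comm = λ (a , b) (c , d) x → trans (sym (t-+ a b c d x))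
        (trans (t-cong (ℤ.+-comm a c) (ℤ.+-comm b d) x) (t-+ c d a b x))
    ; σ-t = λ (m , n) → (ℤ.- n , m) , σ-t m n
    ; half-t = λ (m , n) → σ²-t m n
    ; half-involutive = σ⁴
    ; a = 1ℤ , 0ℤ
    ; α-t = λ x → sym (σ⁴ _)
    ; free = λ i (m , n) → free i m n
    }

-- Maps of hexagons and triangles

-- Quadrivalent incidence structures whose faces are alternately hexagons
-- and triangles: `hexagonal x` says that the face of the dart x is a hexagon.
record Trihexagonal {X : Set} (σ α : X → X) : Set where
  φ : X → X
  φ x = σ (α x)
  field
    σ⁴          : ∀ x → fold x σ 4 ≡ x
    σ²-free     : ∀ x → σ (σ x) ≢ x
    α²          : ∀ x → α (α x) ≡ x
    hexagonal   : X → Bool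
    hexagonal-α : ∀ x → hexagonal (α x) ≡ not (hexagonal x)
    hexagonal-φ : ∀ x → hexagonal (φ x) ≡ hexagonal x
    φ⁶          : ∀ x → hexagonal x ≡ true → fold x φ 6 ≡ x
    φ²-free     : ∀ x → hexagonal x ≡ true → φ (φ x) ≢ x
    φ³-free     : ∀ x → hexagonal x ≡ true → φ (φ (φ x)) ≢ x
    φ³          : ∀ x → hexagonal x ≡ false → φ (φ (φ x)) ≡ x
    φ-free      : ∀ x → hexagonal x ≡ false → φ x ≢ x

-- Turning about hexagons (φ) and about vertices (σ²) makes the darts on
-- hexagons the darts of a triangulation, whose vertices are the hexagons.
module _ {X : Set} {σ α : X → X} (T : Trihexagonal σ α) where
  open Trihexagonal T

  private
    σ³ : X → X
    σ³ x = σ (σ (σ x))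

    hexagonal-σ : ∀ x → hexagonal (σ x) ≡ not (hexagonal x)
    hexagonal-σ x = trans (cong (λ y → hexagonal (σ y)) (sym (α² x))) (trans (hexagonal-φ (α x)) (hexagonal-α x))

    hexagonal-σ² : ∀ x → hexagonal (σ (σ x)) ≡ hexagonal x
    hexagonal-σ² x = trans (hexagonal-σ (σ x)) (trans (cong not (hexagonal-σ x)) (Bool.not-involutive _))

    ασ³φ : ∀ x → α (σ³ (φ x)) ≡ x
    ασ³φ x = trans (cong α (σ⁴ _)) (α² x)

  HexagonDart : Set
  HexagonDart = ∃ λ x → hexagonal x ≡ true

  private
    ≡-dart : {u v : HexagonDart} → proj₁ u ≡ proj₁ v → u ≡ v
    ≡-dart {x , p} {.x , q} refl = cong (x ,_) (≡-irrelevant p q)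

  turnHexagon turnVertex : HexagonDart → HexagonDart
  turnHexagon (x , p) = φ x , trans (hexagonal-φ x) p
  turnVertex  (x , p) = σ (σ x) , trans (hexagonal-σ² x) p

  hexagonDarts-triangular : Triangular turnHexagon turnVertex
  hexagonDarts-triangular = record
    { σ⁶ = λ (x , p) → ≡-dart (φ⁶ x p)
    ; α² = λ (x , p) → ≡-dart (σ⁴ x)
    ; [σα]³ = λ (x , p) → ≡-dart (cubed x p)
    ; σ²-free = λ (x , p) eq → φ²-free x p (cong proj₁ eq)
    ; σ³-free = λ (x , p) eq → φ³-free x p (cong proj₁ eq)
    ; α-free = λ (x , p) eq → σ²-free x (cong proj₁ eq)
    ; σα-free = λ (x , p) eq → free x p (cong proj₁ eq)
    }
    where
    open ≡-Reasoning
    triangular : ∀ x → hexagonal x ≡ true → hexagonal (σ³ x) ≡ false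
    triangular x p = trans (hexagonal-σ _) (cong not (trans (hexagonal-σ² x) p))
    ψ : X → X
    ψ x = α (σ³ x)
    ψ³ : ∀ z → hexagonal z ≡ false → ψ (ψ (ψ z)) ≡ z
    ψ³ z p = begin
      ψ (ψ (ψ z))                ≡⟨ cong (λ y → ψ (ψ (ψ y))) (sym (φ³ z p)) ⟩
      ψ (ψ (ψ (φ (φ (φ z)))))    ≡⟨ cong (λ y → ψ (ψ y)) (ασ³φ _) ⟩
      ψ (ψ (φ (φ z)))            ≡⟨ cong ψ (ασ³φ _) ⟩
      ψ (φ z)                    ≡⟨ ασ³φ z ⟩
      z                          ∎
    -- `φσ²` is the conjugate by `σ` of `ψ`, the inverse of `φ`; and `σ³ x` lies on a triangle,
    -- where `φ` has order three.
    cubed : ∀ x → hexagonal x ≡ true → φ (σ (σ (φ (σ (σ (φ (σ (σ x)))))))) ≡ x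
    cubed x p = begin
      σ (ψ (ψ (α (σ (σ x)))))                 ≡⟨ cong (λ y → σ (ψ (ψ (α (σ (σ y)))))) (sym (σ⁴ x)) ⟩
      σ (ψ (ψ (ψ (σ³ x))))                    ≡⟨ cong σ (ψ³ (σ³ x) (triangular x p)) ⟩
      σ (σ³ x)                                ≡⟨ σ⁴ x ⟩
      x                                       ∎
    free : ∀ x → hexagonal x ≡ true → φ (σ (σ x)) ≢ x
    free x p eq = φ-free (σ³ x) (triangular x p) (begin
      φ (σ³ x)                     ≡⟨ cong (λ y → φ (σ³ y)) (sym eq) ⟩
      φ (σ³ (φ (σ (σ x))))         ≡⟨ cong φ (σ⁴ _) ⟩
      φ (α (σ (σ x)))              ≡⟨ cong σ (α² _) ⟩
      σ³ x                         ∎)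

  private
    -- A dart on a triangle is represented by the next dart at its vertex, which lies on a hexagon.
    -- Every step by `σ` or `α` then becomes a path of turns.
    nearest : ∀ x {b} → hexagonal x ≡ b → HexagonDart
    nearest x {true}  p = x , p
    nearest x {false} p = σ x , trans (hexagonal-σ x) (cong not p)

    nearest-σ : ∀ x {b} (p : hexagonal x ≡ b) (q : hexagonal (σ x) ≡ not b) →
      Star (Step turnHexagon turnVertex) (nearest x p) (nearest (σ x) q)
    nearest-σ x {true}  p q = inj₂ (≡-dart refl) ◅ ε
    nearest-σ x {false} p q = subst (Star _ _) (≡-dart refl) ε

    unturn : ∀ u → Star (Step turnHexagon turnVertex) (turnHexagon u) u
    unturn (x , p) = step ◅ step ◅ step ◅ step ◅ inj₁ (≡-dart (φ⁶ x p)) ◅ ε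
      where
      step : ∀ {u} → Step turnHexagon turnVertex u (turnHexagon u)
      step = inj₁ refl

    nearest-α : ∀ x {b} (p : hexagonal x ≡ b) (q : hexagonal (α x) ≡ not b) →
      Star (Step turnHexagon turnVertex) (nearest x p) (nearest (α x) q)
    nearest-α x {true}  p q = inj₁ (≡-dart refl) ◅ ε
    nearest-α x {false} p q = subst (λ u → Star (Step turnHexagon turnVertex) u _) (≡-dart (cong σ (α² x))) (unturn (α x , q))

    nearest-path : ∀ {x y} → Star (Step σ α) x y → ∀ {b c} (p : hexagonal x ≡ b) (q : hexagonal y ≡ c) →
      Star (Step turnHexagon turnVertex) (nearest x p) (nearest y q)
    nearest-path {x} ε {b} p q with refl ← trans (sym p) q = subst (λ r → Star _ (nearest x p) (nearest x r)) (≡-irrelevant p q) ε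
    nearest-path {x} (inj₁ refl ◅ xs) p q = nearest-σ x p p′ ◅◅ nearest-path xs p′ q
      where p′ = trans (hexagonal-σ x) (cong not p)
    nearest-path {x} (inj₂ refl ◅ xs) p q = nearest-α x p p′ ◅◅ nearest-path xs p′ q
      where p′ = trans (hexagonal-α x) (cong not p)

  hexagonDarts-connected : (∀ x y → Star (Step σ α) x y) → ∀ u v → Star (Step turnHexagon turnVertex) u v
  hexagonDarts-connected connected (x , p) (y , q) = nearest-path (connected x y) p q

  module _ (θ : Automorphism turnHexagon turnVertex) where
    open Automorphism θ

    private
      other : ∀ {x} → hexagonal x ≡ false → hexagonal (α x) ≡ true
      other p = trans (hexagonal-α _) (cong not p)

      -- `α` exchanges hexagon and triangle darts, so commuting with `α` dictates the values on
      -- triangles. The Boolean and its equation are arguments so that `extend-≡` can substitute a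
      -- known side.
      extend′ : (HexagonDart → HexagonDart) → ∀ x {b} → hexagonal x ≡ b → X
      extend′ f x {true}  p = proj₁ (f (x , p))
      extend′ f x {false} p = α (proj₁ (f (α x , other p)))

      extend : (HexagonDart → HexagonDart) → X → X
      extend f x = extend′ f x refl

      extend-≡ : ∀ f x {b} (p : hexagonal x ≡ b) → extend f x ≡ extend′ f x p
      extend-≡ f x refl = refl

      extend-α : ∀ f x → extend f (α x) ≡ α (extend f x)
      extend-α f x = go (hexagonal x) refl
        where
        go : ∀ b → hexagonal x ≡ b → extend f (α x) ≡ α (extend f x)
        go true p = trans (extend-≡ f (α x) (trans (hexagonal-α x) (cong not p)))
          (trans (cong (λ u → α (proj₁ (f u))) (≡-dart (α² x))) (cong α (sym (extend-≡ f x p))))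
        go false p = trans (extend-≡ f (α x) (other p))
          (trans (sym (α² _)) (cong α (sym (extend-≡ f x p))))

      extend-inverse : ∀ f g → (∀ u → f (g u) ≡ u) → ∀ x → extend f (extend g x) ≡ x
      extend-inverse f g fg x = go (hexagonal x) refl
        where
        on-hexagon : ∀ x → hexagonal x ≡ true → extend f (extend g x) ≡ x
        on-hexagon x p = trans (cong (extend f) (extend-≡ g x p))
          (trans (extend-≡ f _ (proj₂ (g (x , p)))) (cong proj₁ (fg (x , p))))
        go : ∀ b → hexagonal x ≡ b → extend f (extend g x) ≡ x
        go true p = on-hexagon x p
        go false p = begin
          extend f (extend g x)              ≡⟨ cong (λ y → extend f (extend g y)) (sym (α² x)) ⟩
          extend f (extend g (α (α x)))      ≡⟨ cong (extend f) (extend-α g (α x)) ⟩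
          extend f (α (extend g (α x)))      ≡⟨ extend-α f _ ⟩
          α (extend f (extend g (α x)))      ≡⟨ cong α (on-hexagon (α x) (other p)) ⟩
          α (α x)                            ≡⟨ α² x ⟩
          x                                  ∎
          where open ≡-Reasoning

      extend-φ : ∀ x → hexagonal x ≡ true → extend to (φ x) ≡ φ (extend to x)
      extend-φ x p = trans (extend-≡ to (φ x) (trans (hexagonal-φ x) p))
        (trans (cong proj₁ (to-σ (x , p))) (cong φ (sym (extend-≡ to x p))))

      extend-σ : ∀ x → extend to (σ x) ≡ σ (extend to x)
      extend-σ x = go (hexagonal x) refl
        where
        open ≡-Reasoning
        on-triangle : ∀ x → hexagonal x ≡ false → extend to (σ x) ≡ σ (extend to x)
        on-triangle x p = begin
          extend to (σ x)               ≡⟨ cong (λ y → extend to (σ y)) (sym (α² x)) ⟩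
          extend to (φ (α x))           ≡⟨ extend-φ (α x) (other p) ⟩
          φ (extend to (α x))           ≡⟨ cong φ (extend-α to x) ⟩
          σ (α (α (extend to x)))       ≡⟨ cong σ (α² _) ⟩
          σ (extend to x)               ∎
        go : ∀ b → hexagonal x ≡ b → extend to (σ x) ≡ σ (extend to x)
        go false p = on-triangle x p
        -- Leaving a hexagon dart, only `σ²` is a turn respected by `to`. The triangle case at `σ x`
        -- supplies the second `σ`, which is then cancelled.
        go true p = begin
          extend to (σ x)                                 ≡⟨ sym (σ⁴ _) ⟩
          σ³ (σ (extend to (σ x)))                        ≡⟨ cong σ³ (sym (on-triangle (σ x) (trans (hexagonal-σ x) (cong not p)))) ⟩
          σ³ (extend to (σ (σ x)))                        ≡⟨ cong σ³ (extend-≡ to (σ (σ x)) (trans (hexagonal-σ² x) p)) ⟩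
          σ³ (proj₁ (to (turnVertex (x , p))))                  ≡⟨ cong (λ u → σ³ (proj₁ u)) (to-α (x , p)) ⟩
          σ³ (σ (σ (proj₁ (to (x , p)))))                 ≡⟨ σ⁴ _ ⟩
          σ (proj₁ (to (x , p)))                          ≡⟨ cong σ (sym (extend-≡ to x p)) ⟩
          σ (extend to x)                                 ∎

    extendAutomorphism : Automorphism σ α
    extendAutomorphism = record
      { to = extend to ; from = extend from
      ; to-from = extend-inverse to from to-from ; from-to = extend-inverse from to from-to
      ; to-σ = extend-σ ; to-α = extend-α to }

    extendAutomorphism-to : ∀ u → Automorphism.to extendAutomorphism (proj₁ u) ≡ proj₁ (to u)
    extendAutomorphism-to (x , p) = extend-≡ to x p

-- Orbits of edges

Unique-⊆⇒length-≤ : {A : Set} {xs ys : List A} → Unique xs → (∀ {x} → x ∈ xs → x ∈ ys) → length xs ≤ length ys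
Unique-⊆⇒length-≤ {xs = []} _ _ = z≤n
Unique-⊆⇒length-≤ {xs = x ∷ xs} (x∉xs ∷ unique) xs⊆ys with as , bs , refl ← ∈-∃++ (xs⊆ys (here refl)) =
  subst (suc (length xs) ≤_) (sym (trans (length-++ as) (trans (ℕ.+-suc _ _) (cong suc (sym (length-++ as))))))
    (s≤s (Unique-⊆⇒length-≤ unique remaining))
  where
  remaining : ∀ {y} → y ∈ xs → y ∈ as ++ bs
  remaining y∈xs with ∈-++⁻ as (xs⊆ys (there y∈xs))
  ... | inj₁ y∈as          = ∈-++⁺ˡ y∈as
  ... | inj₂ (here refl)   = contradiction refl (All.lookup x∉xs y∈xs)
  ... | inj₂ (there y∈bs)  = ∈-++⁺ʳ as y∈bs

injective⇒strictlySurjective : ∀ {n} (f : Fin n → Fin n) → (∀ {i j} → f i ≡ f j → i ≡ j) → ∀ c → ∃ λ i → f i ≡ c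
injective⇒strictlySurjective {suc n} f injective c with Fin.any? (λ i → f i Fin.≟ c)
... | yes found = found
... | no  avoids = contradiction (Fin.injective⇒≤ {f = λ i → punchOut (c≢ i)}
  (λ {i} {j} eq → injective (Fin.punchOut-injective (c≢ i) (c≢ j) eq))) ℕ.1+n≰n
  where
  c≢ : ∀ i → c ≢ f i
  c≢ i c≡fi = avoids (i , sym c≡fi)

-- Least periods and lengths of cycles

record IsPeriod {A : Set} (f : A → A) (x : A) (n : ℕ) : Set where
  field
    positive : 0 < n
    returns  : fold x f n ≡ x
    minimal  : ∀ i → 0 < i → i < n → fold x f i ≢ x
open IsPeriod

IsPeriod-unique : {A : Set} {f : A → A} {x : A} {m n : ℕ} → IsPeriod f x m → IsPeriod f x n → m ≡ n
IsPeriod-unique {m = m} {n} p q with ℕ.<-cmp m n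
... | tri< m<n _ _ = contradiction (returns p) (minimal q m (positive p) m<n)
... | tri≈ _ m≡n _ = m≡n
... | tri> _ _ n<m = contradiction (returns q) (minimal p n (positive q) n<m)

period : ∀ {n} (f : Fin n → Fin n) x k → fold x f (suc k) ≡ x → ∃ (IsPeriod f x)
period f x k eq
  with i , returns , minimal ← Fin.¬∀⟶∃¬-smallest (suc k) (λ i → fold x f (suc (toℕ i)) ≢ x)
    (λ i → ¬? (fold x f (suc (toℕ i)) Fin.≟ x))
    (λ never → never (fromℕ k) (trans (cong (λ i → fold x f (suc i)) (Fin.toℕ-fromℕ k)) eq))
  = suc (toℕ i) , record
    { positive = z<s
    ; returns = decidable-stable (_ Fin.≟ x) returns
    ; minimal = λ { (suc j) _ (s≤s j<i) → subst (λ l → fold x f (suc l) ≢ x)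
        (trans (Fin.toℕ-inject (fromℕ< j<i)) (Fin.toℕ-fromℕ< j<i)) (minimal (fromℕ< j<i)) }
    }

module _ {n c : ℕ} {f : Fin n → Fin n} {q : Fin n → Fin c} (Q : IsQuotient (InCycle f) q) where
  open IsQuotient Q

  representative : Fin c → Fin n
  representative = proj₁ ∘ surjective

  cycle-step : ∀ x → q (f x) ≡ q x
  cycle-step x = sym (⇒ (classes _ _) (1 , refl))

  same-cycle : ∀ {x y} → q x ≡ q y → ∃ λ k → fold x f k ≡ y
  same-cycle {x} {y} eq = let k , eq′ = ⇐ (classes x y) eq in k , trans (iterate-is-fold x f k) eq′

  cycle-fold : ∀ x k → q (fold x f k) ≡ q x
  cycle-fold x zero    = refl
  cycle-fold x (suc k) = trans (cycle-step _) (cycle-fold x k)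

  private
    return-time : ∀ x → ∃ λ k → fold x f (suc k) ≡ x
    return-time x = let k , eq = same-cycle (cycle-step x) in k , trans (sym (fold-shift f x k)) eq

  -- The iterates below the least period are distinct and exhaust the class of `x`. This turns
  -- valences and face sizes, defined by counting darts, into orders of `σ` and `φ` at a dart.
  cycle-length : ∀ x → IsPeriod f x (length (filter (λ y → q y Fin.≟ q x) (allFin n)))
  cycle-length x with period f x (proj₁ (return-time x)) (proj₂ (return-time x))
  ... | suc d , p = subst (IsPeriod f x) (ℕ.≤-antisym orbit≤class class≤orbit) p
    where
    orbit : List (Fin n)
    orbit = applyUpTo (fold x f) (suc d)
    class : List (Fin n)
    class = filter (λ y → q y Fin.≟ q x) (allFin n)

    distinct : ∀ {i j} → i < j → j < suc d → fold x f i ≢ fold x f j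
    -- Completing the period from `j`, in `suc d ∸ j` further steps, makes a coincidence into an
    -- early return to `x`.
    distinct {i} {j} i<j j<d eq = minimal p (k + i) 0<k+i k+i<d (begin
      fold x f (k + i)            ≡⟨ fold-+ x f k ⟩
      fold (fold x f i) f k       ≡⟨ cong (λ y → fold y f k) eq ⟩
      fold (fold x f j) f k       ≡⟨ sym (fold-+ x f k) ⟩
      fold x f (k + j)            ≡⟨ cong (fold x f) (ℕ.m∸n+n≡m (ℕ.<⇒≤ j<d)) ⟩
      fold x f (suc d)            ≡⟨ returns p ⟩
      x                           ∎)
      where
      open ≡-Reasoning
      k = suc d ∸ j
      0<k+i : 0 < k + i
      0<k+i = ℕ.≤-trans (ℕ.m<n⇒0<n∸m j<d) (ℕ.m≤m+n k i)
      k+i<d : k + i < suc d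
      k+i<d = subst (k + i <_) (ℕ.m∸n+n≡m (ℕ.<⇒≤ j<d)) (ℕ.+-monoʳ-< k i<j)

    class⊆orbit : ∀ {y} → y ∈ class → y ∈ orbit
    class⊆orbit y∈class =
      let _ , eq = ∈-filter⁻ (λ y → q y Fin.≟ q x) {xs = allFin n} y∈class ; k , eq′ = same-cycle (sym eq)
      in subst (_∈ orbit) (trans (sym (order-mod f (suc d) (returns p) k)) eq′) (∈-applyUpTo⁺ (fold x f) (m%n<n k (suc d)))

    orbit⊆class : ∀ {y} → y ∈ orbit → y ∈ class
    orbit⊆class y∈orbit with i , _ , refl ← ∈-applyUpTo⁻ (fold x f) y∈orbit =
      ∈-filter⁺ (λ y → q y Fin.≟ q x) (∈-allFin _) (cycle-fold x i)

    orbit≤class : suc d ≤ length class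
    orbit≤class = subst (_≤ length class) (length-applyUpTo (fold x f) (suc d))
      (Unique-⊆⇒length-≤ (Unique.applyUpTo⁺₁ (fold x f) (suc d) distinct) orbit⊆class)

    class≤orbit : length class ≤ suc d
    class≤orbit = subst (length class ≤_) (length-applyUpTo (fold x f) (suc d))
      (Unique-⊆⇒length-≤ (Unique.filter⁺ (λ y → q y Fin.≟ q x) (Unique.allFin⁺ n)) class⊆orbit)

  module _ (θ : Fin n → Fin n) (θ-f : ∀ x → θ (f x) ≡ f (θ x)) where

    induced-cong : ∀ {x y} → q x ≡ q y → q (θ x) ≡ q (θ y)
    induced-cong {x} {y} eq = let k , eq′ = same-cycle eq in
      trans (sym (cycle-fold (θ x) k)) (cong q (trans (sym (fold-commute θ f f θ-f k x)) (cong θ eq′)))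

    induced : Fin c → Fin c
    induced = q ∘ θ ∘ representative

    induced-q : ∀ x → induced (q x) ≡ q (θ x)
    induced-q x = induced-cong (proj₂ (surjective (q x)))

-- Reaching either dart of an edge suffices; in a map of hexagons and triangles only the dart on the
-- hexagon is reached.
DartOrbits : {X : Set} (σ α : X → X) → ℕ → Set
DartOrbits {X} σ α h = ∃ λ (r : Fin h → X) → ∀ x → ∃₂ λ (c : Fin h) (θ : Automorphism σ α) →
  Automorphism.to θ (r c) ≡ x ⊎ Automorphism.to θ (r c) ≡ α x

lattice⇒dartOrbits : ∀ {X : Set} {σ α : X → X} {h} .{{_ : ℕ.NonZero h}} → LatticeAction σ α h →
  (∀ x y → Star (Step σ α) x y) → X → DartOrbits σ α h
lattice⇒dartOrbits {σ = σ} L connected o = (λ c → fold o σ (toℕ c)) , λ x →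
  let c , θ , eq = LatticeAction.orbits L connected o x in c , θ , inj₁ eq

trihexagonal⇒dartOrbits : ∀ {X : Set} {σ α : X → X} (T : Trihexagonal σ α) →
  (∀ x y → Star (Step σ α) x y) → X → DartOrbits σ α 3
trihexagonal⇒dartOrbits {X} {σ} {α} T connected o = (λ c → proj₁ (r c)) , λ x → go x (hexagonal x) refl
  where
  open Trihexagonal T
  hexagonDart : ∀ x → HexagonDart T
  hexagonDart x with hexagonal x in eq
  ... | true  = x , eq
  ... | false = α x , trans (hexagonal-α x) (cong not eq)
  base : HexagonDart T
  base = hexagonDart o
  r : Fin 3 → HexagonDart T
  r c = fold base (turnHexagon T) (toℕ c)
  orbits : ∀ u → ∃₂ λ (c : Fin 3) (θ : Automorphism (turnHexagon T) (turnVertex T)) → Automorphism.to θ (r c) ≡ u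
  orbits = LatticeAction.orbits (triangularAction (hexagonDarts-triangular T)) (hexagonDarts-connected T connected) base
  onHexagons : ∀ u → ∃₂ λ (c : Fin 3) (θ : Automorphism σ α) → Automorphism.to θ (proj₁ (r c)) ≡ proj₁ u
  onHexagons u = let c , θ , eq = orbits u in
    c , extendAutomorphism T θ , trans (extendAutomorphism-to T θ (r c)) (cong proj₁ eq)
  go : ∀ x b → hexagonal x ≡ b → ∃₂ λ (c : Fin 3) (θ : Automorphism σ α) →
    Automorphism.to θ (proj₁ (r c)) ≡ x ⊎ Automorphism.to θ (proj₁ (r c)) ≡ α x
  go x true  p = let c , θ , eq = onHexagons (x , p) in c , θ , inj₁ eq
  go x false p = let c , θ , eq = onHexagons (α x , trans (hexagonal-α x) (cong not p)) in c , θ , inj₂ eq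

-- The dual has the same darts and the same `α`, and `σ` is recovered as `(σ ∘ α) ∘ α`, so the
-- automorphisms are the same bijections.
undual : ∀ {X : Set} {σ α : X → X} {h} → (∀ x → α (α x) ≡ x) → DartOrbits (σ ∘ α) α h → DartOrbits σ α h
undual {σ = σ} {α} α² (r , orbits) = r , λ x → let c , θ , eq = orbits x in c , undualθ θ , eq
  where
  undualθ : Automorphism (σ ∘ α) α → Automorphism σ α
  undualθ θ = record
    { to = to ; from = from ; to-from = to-from ; from-to = from-to ; to-α = to-α
    ; to-σ = λ x → trans (cong (to ∘ σ) (sym (α² x))) (trans (to-σ (α x))
        (cong σ (trans (cong α (to-α x)) (α² (to x))))) }
    where open Automorphism θ

module _ (E : CellularEmbedding) where
  open CellularEmbedding E

  edge-darts : ∀ {x y} → edge x ≡ edge y → y ≡ x ⊎ y ≡ α x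
  edge-darts {x} eq = let k , eq′ = same-cycle edges-cycles eq in go k eq′
    where
    go : ∀ k {y} → fold x α k ≡ y → y ≡ x ⊎ y ≡ α x
    go zero          eq = inj₁ (sym eq)
    go (suc zero)    eq = inj₂ (sym eq)
    go (suc (suc k)) eq = go k (trans (sym (α-involutive _)) eq)

-- From automorphisms on darts to orbits of edges

module _ (K : Map) where
  open Map K

  module _ (θ : Automorphism σ α) where
    open Automorphism θ

    vertexPermutation : Permutation′ #vertices
    vertexPermutation = permutation (induced vertices-cycles to to-σ) (induced vertices-cycles from from-σ)
      (cancel to to-σ from from-σ to-from) (cancel from from-σ to to-σ from-to)
      where
      cancel : ∀ f fσ g gσ → (∀ x → f (g x) ≡ x) → ∀ v →
        induced vertices-cycles f fσ (induced vertices-cycles g gσ v) ≡ v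
      cancel f fσ g gσ fg v = let x , eq = IsQuotient.surjective vertices-cycles v in
        trans (induced-q vertices-cycles f fσ _) (trans (cong vertex (fg _)) eq)

    private
      maps-cell : ∀ {c} {f : Dart → Dart} {q : Dart → Fin c} (Q : IsQuotient (InCycle f) q) →
        (∀ x → to (f x) ≡ f (to x)) → (∀ x → from (f x) ≡ f (from x)) → ∀ x v →
        (∃ λ y → q y ≡ q x × vertex y ≡ v) ⇔
        (∃ λ y → q y ≡ q (to x) × vertex y ≡ vertexPermutation ⟨$⟩ʳ v)
      maps-cell {q = q} Q to-f from-f x v = mk⇔
        (λ { (y , q≡ , refl) → to y , induced-cong Q to to-f q≡ , sym (induced-q vertices-cycles to to-σ y) })
        (λ { (y , q≡ , v≡) → from y , trans (induced-cong Q from from-f q≡) (cong q (from-to x)) ,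
          trans (sym (induced-q vertices-cycles from from-σ y))
            (trans (cong (induced vertices-cycles from from-σ) v≡) (inverseˡ vertexPermutation)) })

    to-φ : ∀ x → to (φ x) ≡ φ (to x)
    to-φ x = trans (to-σ (α x)) (cong σ (to-α x))

    from-φ : ∀ x → from (φ x) ≡ φ (from x)
    from-φ x = trans (from-σ (α x)) (cong σ (from-α x))

    maps-edge : ∀ x → MapsEdge K vertexPermutation (edge x) (edge (to x))
    maps-edge = maps-cell edges-cycles to-α from-α

    maps-face : ∀ x → MapsFace K vertexPermutation (face x) (face (to x))
    maps-face = maps-cell faces-cycles to-φ from-φ

    mapsCellsToCells : MapsCellsToCells K vertexPermutation
    mapsCellsToCells =
      (λ e → let x , eq = IsQuotient.surjective edges-cycles e in
        edge (to x) , subst (λ e → MapsEdge K vertexPermutation e (edge (to x))) eq (maps-edge x)) ,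
      (λ f → let x , eq = IsQuotient.surjective faces-cycles f in
        face (to x) , subst (λ f → MapsFace K vertexPermutation f (face (to x))) eq (maps-face x))

  automorphism⇒sameOrbit : (θ : Automorphism σ α) → ∀ x → SameOrbit K (edge x) (edge (Automorphism.to θ x))
  automorphism⇒sameOrbit θ x = vertexPermutation θ ,
    (mapsCellsToCells θ , mapsCellsToCells (Automorphism.inverse θ)) , maps-edge θ x

  sameOrbit-sym : ∀ {e e′} → SameOrbit K e e′ → SameOrbit K e′ e
  sameOrbit-sym {e} {e′} (π , (cells , cells⁻¹) , maps) = flip π , (cells⁻¹ , cells) , λ v →
    subst (λ w → w ∈ᵉ e′ ⇔ (flip π ⟨$⟩ʳ v) ∈ᵉ e) (inverseʳ π) (mk⇔ (⇐ (maps _)) (⇒ (maps _)))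

  private
    mapsCells-trans : ∀ {π ρ} → MapsCellsToCells K π → MapsCellsToCells K ρ → MapsCellsToCells K (π ∘ₚ ρ)
    mapsCells-trans (πE , πF) (ρE , ρF) =
      (λ e → let e′ , p = πE e ; e″ , q = ρE e′ in e″ , λ v → mk⇔ (⇒ (q _) ∘ ⇒ (p v)) (⇐ (p v) ∘ ⇐ (q _))) ,
      (λ f → let f′ , p = πF f ; f″ , q = ρF f′ in f″ , λ v → mk⇔ (⇒ (q _) ∘ ⇒ (p v)) (⇐ (p v) ∘ ⇐ (q _)))

  sameOrbit-trans : ∀ {e e′ e″} → SameOrbit K e e′ → SameOrbit K e′ e″ → SameOrbit K e e″
  sameOrbit-trans (π , (cells , cells⁻¹) , p) (ρ , (cells′ , cells′⁻¹) , q) =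
    π ∘ₚ ρ , (mapsCells-trans {π} {ρ} cells cells′ , mapsCells-trans {flip ρ} {flip π} cells′⁻¹ cells⁻¹) ,
    λ v → mk⇔ (⇒ (q _) ∘ ⇒ (p v)) (⇐ (p v) ∘ ⇐ (q _))

  OrbitRepresentatives : ℕ → Set
  OrbitRepresentatives h = ∃ λ (r : Fin h → Edge) → ∀ e → ∃ λ c → SameOrbit K (r c) e

  dartOrbits⇒orbitRepresentatives : ∀ {h} → DartOrbits σ α h → OrbitRepresentatives h
  dartOrbits⇒orbitRepresentatives (r , orbits) = edge ∘ r , λ e →
    let x , edge≡ = IsQuotient.surjective edges-cycles e ; c , θ , to≡ = orbits x in
    c , subst (SameOrbit K (edge (r c))) (trans (same x to≡) edge≡) (automorphism⇒sameOrbit θ (r c))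
    where
    same : ∀ x {y} → y ≡ x ⊎ y ≡ α x → edge y ≡ edge x
    same x (inj₁ refl) = refl
    same x (inj₂ refl) = cycle-step edges-cycles x

  module _ {h} (reps : OrbitRepresentatives h) where
    private
      class : Edge → Fin h
      class = proj₁ ∘ proj₂ reps

      same-class : ∀ {e e′} → class e ≡ class e′ → SameOrbit K e e′
      same-class {e} {e′} eq = sameOrbit-trans (sameOrbit-sym (proj₂ (proj₂ reps e)))
        (subst (λ c → SameOrbit K (proj₁ reps c) e′) (sym eq) (proj₂ (proj₂ reps e′)))

    orbits-≤ : ∀ {N} → HasEdgeOrbits K N → N ≤ h
    orbits-≤ (q , Q) = Fin.injective⇒≤ {f = class ∘ proj₁ ∘ surjective} λ {m} {n} eq →
      trans (sym (proj₂ (surjective m))) (trans (⇒ (classes _ _) (same-class eq)) (proj₂ (surjective n)))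
      where open IsQuotient Q

    -- The representatives might share orbits. The inequivalent edges exclude this: `class ∘ s` is
    -- an injection of `Fin h` into itself, hence onto, so the classes are exactly the orbits.
    inequivalent⇒hasEdgeOrbits : (s : Fin h → Edge) → (∀ i j → SameOrbit K (s i) (s j) → i ≡ j) → HasEdgeOrbits K h
    inequivalent⇒hasEdgeOrbits s inequivalent = class , record
      { surjective = λ c → let i , eq = onto c in s i , eq
      ; classes = λ e e′ → mk⇔ same⇒class≡ same-class
      }
      where
      onto : ∀ c → ∃ λ i → class (s i) ≡ c
      onto = injective⇒strictlySurjective (class ∘ s) λ eq → inequivalent _ _ (same-class eq)
      same⇒class≡ : ∀ {e e′} → SameOrbit K e e′ → class e ≡ class e′
      same⇒class≡ {e} {e′} same = let i , i≡ = onto (class e) ; j , j≡ = onto (class e′) in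
        trans (sym i≡) (trans (cong (class ∘ s) (inequivalent i j
          (sameOrbit-trans (same-class i≡) (sameOrbit-trans same (sameOrbit-sym (same-class j≡)))))) j≡)

-- Edge-symbols as orders of rotations

SamePair-swap : ∀ {a b c d} → SamePair a b c d → SamePair b a c d
SamePair-swap (inj₁ (p , q)) = inj₂ (q , p)
SamePair-swap (inj₂ (p , q)) = inj₁ (q , p)

SamePair-diagonal : ∀ {a b c} → SamePair a b c c → a ≡ c
SamePair-diagonal (inj₁ (p , _)) = p
SamePair-diagonal (inj₂ (p , _)) = p

fold-ext : ∀ {X : Set} {f g : X → X} → (∀ x → f x ≡ g x) → ∀ n x → fold x f n ≡ fold x g n
fold-ext f≗g zero    x = refl
fold-ext {g = g} f≗g (suc n) x = trans (f≗g _) (cong g (fold-ext f≗g n x))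

-- The rotation φ about faces is kept apart from σ ∘ α, so that these lemmas
-- apply to a map and, with σ and φ exchanged, to its dual.
module _ {X : Set} {σ α φ : X → X} (α² : ∀ x → α (α x) ≡ x) (α-free : ∀ x → α x ≢ x)
         (σα≗φ : ∀ x → σ (α x) ≡ φ x) where
  periods⇒triangular : (∀ x → IsPeriod σ x 6) → (∀ x → IsPeriod φ x 3) → Triangular σ α
  periods⇒triangular pσ pφ = record
    { σ⁶ = λ x → returns (pσ x)
    ; α² = α²
    ; [σα]³ = λ x → trans (fold-ext σα≗φ 3 x) (returns (pφ x))
    ; σ²-free = λ x → minimal (pσ x) 2 z<s (from-yes (2 <? 6))
    ; σ³-free = λ x → minimal (pσ x) 3 z<s (from-yes (3 <? 6))
    ; α-free = α-free
    ; σα-free = λ x eq → minimal (pφ x) 1 z<s (from-yes (1 <? 3)) (trans (sym (σα≗φ x)) eq)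
    }

  periods⇒quadrangular : (∀ x → IsPeriod σ x 4) → (∀ x → IsPeriod φ x 4) → Quadrangular σ α
  periods⇒quadrangular pσ pφ = record
    { σ⁴ = λ x → returns (pσ x)
    ; α² = α²
    ; [σα]⁴ = λ x → trans (fold-ext σα≗φ 4 x) (returns (pφ x))
    ; σ²-free = λ x → minimal (pσ x) 2 z<s (from-yes (2 <? 4))
    ; α-free = α-free
    ; [σα]²-free = λ x eq → minimal (pφ x) 2 z<s (from-yes (2 <? 4)) (trans (sym (fold-ext σα≗φ 2 x)) eq)
    }

  periods⇒trihexagonal : (∀ x → IsPeriod σ x 4) → (size : X → ℕ) → (∀ x → IsPeriod φ x (size x)) →
    (∀ x → size (φ x) ≡ size x) → (∀ x → SamePair (size x) (size (α x)) 3 6) → Trihexagonal σ α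
  periods⇒trihexagonal pσ size pφ size-φ pair = record
    { σ⁴ = λ x → returns (pσ x)
    ; σ²-free = λ x → minimal (pσ x) 2 z<s (from-yes (2 <? 4))
    ; α² = α²
    ; hexagonal = hexagonal
    ; hexagonal-α = hexagonal-α
    ; hexagonal-φ = λ x → cong (λ n → does (n ≟ 6)) (trans (cong size (σα≗φ x)) (size-φ x))
    ; φ⁶ = λ x p → trans (fold-ext σα≗φ 6 x) (returns (hexagon x p))
    ; φ²-free = λ x p eq → minimal (hexagon x p) 2 z<s (from-yes (2 <? 6)) (trans (sym (fold-ext σα≗φ 2 x)) eq)
    ; φ³-free = λ x p eq → minimal (hexagon x p) 3 z<s (from-yes (3 <? 6)) (trans (sym (fold-ext σα≗φ 3 x)) eq)
    ; φ³ = λ x p → trans (fold-ext σα≗φ 3 x) (returns (triangle x p))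
    ; φ-free = λ x p eq → minimal (triangle x p) 1 z<s (from-yes (1 <? 3)) (trans (sym (σα≗φ x)) eq)
    }
    where
    hexagonal : X → Bool
    hexagonal x = does (size x ≟ 6)
    hexagonal-α : ∀ x → hexagonal (α x) ≡ not (hexagonal x)
    hexagonal-α x with pair x
    ... | inj₁ (p , q) rewrite p | q = refl
    ... | inj₂ (p , q) rewrite p | q = refl
    hexagon : ∀ x → hexagonal x ≡ true → IsPeriod φ x 6
    hexagon x p with pair x
    ... | inj₁ (q , _) = contradiction (trans (sym p) (cong (λ n → does (n ≟ 6)) q)) λ ()
    ... | inj₂ (q , _) = subst (IsPeriod φ x) q (pφ x)
    triangle : ∀ x → hexagonal x ≡ false → IsPeriod φ x 3
    triangle x p with pair x
    ... | inj₁ (q , _) = subst (IsPeriod φ x) q (pφ x)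
    ... | inj₂ (q , _) = contradiction (trans (sym p) (cong (λ n → does (n ≟ 6)) q)) λ ()

module _ (K : Map) where
  open Map K

  private
    someDart : Dart
    someDart = fromℕ< nonempty

    φα≗σ : ∀ x → φ (α x) ≡ σ x
    φα≗σ x = cong σ (α-involutive x)

    dual-connected : ∀ x y → Star (Step φ α) x y
    dual-connected x y = kleisliStar id step (connected x y)
      where
      step : ∀ {x y} → Step σ α x y → Star (Step φ α) x y
      step (inj₁ refl) = inj₂ refl ◅ inj₁ (φα≗σ _) ◅ ε
      step (inj₂ eq)   = inj₂ eq ◅ ε

    σ-period : ∀ x {n} → valence (vertex x) ≡ n → IsPeriod σ x n
    σ-period x eq = subst (IsPeriod σ x) eq (cycle-length vertices-cycles x)

    φ-period : ∀ x {n} → size (face x) ≡ n → IsPeriod φ x n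
    φ-period x eq = subst (IsPeriod φ x) eq (cycle-length faces-cycles x)

  module _ {m ℓ u v : ℕ} (homogeneous : EdgeHomogeneous K (m , ℓ , u , v)) where

    -- Homogeneity gives the symbol at one unspecified dart of each edge; as the pairs are
    -- unordered, it passes to the other dart.
    dart-symbol : ∀ x → SamePair (size (face x)) (size (face (α x))) m ℓ ×
                        SamePair (valence (vertex x)) (valence (vertex (α x))) u v
    dart-symbol x with y , y≡ , sizes , valences ← homogeneous (edge x) with edge-darts embedding y≡
    ... | inj₁ refl = sizes , valences
    ... | inj₂ refl = swap (λ x → size (face x)) sizes , swap (λ x → valence (vertex x)) valences
      where
      swap : ∀ (f : Dart → ℕ) {c d} → SamePair (f y) (f (α y)) c d → SamePair (f (α y)) (f (α (α y))) c d
      swap f {c} {d} p = subst (λ n → SamePair (f (α y)) n c d) (sym (cong f (α-involutive y))) (SamePair-swap p)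

  orbits-3366 : EdgeHomogeneous K (3 , 3 , 6 , 6) → OrbitRepresentatives K 3
  orbits-3366 hom = dartOrbits⇒orbitRepresentatives K (lattice⇒dartOrbits (triangularAction
    (periods⇒triangular α-involutive α-fixedPointFree (λ _ → refl)
      (λ x → σ-period x (SamePair-diagonal (proj₂ (dart-symbol hom x))))
      (λ x → φ-period x (SamePair-diagonal (proj₁ (dart-symbol hom x))))))
    connected someDart)

  orbits-6633 : EdgeHomogeneous K (6 , 6 , 3 , 3) → OrbitRepresentatives K 3
  orbits-6633 hom = dartOrbits⇒orbitRepresentatives K (undual α-involutive (lattice⇒dartOrbits (triangularAction
    (periods⇒triangular α-involutive α-fixedPointFree φα≗σ
      (λ x → φ-period x (SamePair-diagonal (proj₁ (dart-symbol hom x))))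
      (λ x → σ-period x (SamePair-diagonal (proj₂ (dart-symbol hom x))))))
    dual-connected someDart))

  orbits-3644 : EdgeHomogeneous K (3 , 6 , 4 , 4) → OrbitRepresentatives K 3
  orbits-3644 hom = dartOrbits⇒orbitRepresentatives K (trihexagonal⇒dartOrbits
    (periods⇒trihexagonal α-involutive α-fixedPointFree (λ _ → refl)
      (λ x → σ-period x (SamePair-diagonal (proj₂ (dart-symbol hom x))))
      (λ x → size (face x)) (λ x → φ-period x refl)
      (λ x → cong size (cycle-step faces-cycles x))
      (λ x → proj₁ (dart-symbol hom x)))
    connected someDart)

  orbits-4436 : EdgeHomogeneous K (4 , 4 , 3 , 6) → OrbitRepresentatives K 3
  orbits-4436 hom = dartOrbits⇒orbitRepresentatives K (undual α-involutive (trihexagonal⇒dartOrbits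
    (periods⇒trihexagonal α-involutive α-fixedPointFree φα≗σ
      (λ x → φ-period x (SamePair-diagonal (proj₁ (dart-symbol hom x))))
      (λ x → valence (vertex x)) (λ x → σ-period x refl)
      (λ x → cong valence (cycle-step vertices-cycles x))
      (λ x → proj₂ (dart-symbol hom x)))
    dual-connected someDart))

  orbits-4444 : EdgeHomogeneous K (4 , 4 , 4 , 4) → OrbitRepresentatives K 2
  orbits-4444 hom = dartOrbits⇒orbitRepresentatives K (lattice⇒dartOrbits (quadrangularAction
    (periods⇒quadrangular α-involutive α-fixedPointFree (λ _ → refl)
      (λ x → σ-period x (SamePair-diagonal (proj₂ (dart-symbol hom x))))
      (λ x → φ-period x (SamePair-diagonal (proj₁ (dart-symbol hom x))))))
    connected someDart)

-- Embeddings with numbered darts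

allBelow? : {P : ℕ → Set} → (∀ i → Dec (P i)) → ∀ n → Dec (∀ i → i < n → P i)
allBelow? P? zero    = yes λ _ ()
allBelow? {P} P? (suc n) = map′ (λ (p , ps) → extend p ps) (λ ps → ps n ℕ.≤-refl , λ i i<n → ps i (ℕ.m<n⇒m<1+n i<n))
  (P? n ×-dec allBelow? P? n)
  where
  extend : P n → (∀ i → i < n → P i) → ∀ i → i < suc n → P i
  extend p ps i i<1+n = [ ps i , (λ { refl → p }) ]′ (ℕ.m<1+n⇒m<n∨m≡n i<1+n)

anyBelow? : {P : ℕ → Set} → (∀ i → Dec (P i)) → ∀ n → Dec (∃ λ i → i < n × P i)
anyBelow? P? zero    = no λ ()
anyBelow? {P} P? (suc n) = map′ [ (λ p → n , ℕ.≤-refl , p) , (λ (i , i<n , p) → i , ℕ.m<n⇒m<1+n i<n , p) ]′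
  (λ (i , i<1+n , p) → [ (λ i<n → inj₂ (i , i<n , p)) , (λ i≡n → inj₁ (subst P i≡n p)) ]′ (ℕ.m<1+n⇒m<n∨m≡n i<1+n))
  (P? n ⊎-dec anyBelow? P? n)

-- An embedding given by numbering its darts, vertices, edges and faces.  The
-- orders of σ and φ divide p and q, and one of the words in σ (true) and
-- α (false) leads from each dart to the next one, which shows connectedness.
record Presentation : Set where
  field
    #darts #vertices #edges #faces p q : ℕ
    σ α vertex edge face vertexDart edgeDart faceDart : ℕ → ℕ
    words : List (List Bool)

  φ : ℕ → ℕ
  φ x = σ (α x)

act : {X : Set} → (X → X) → (X → X) → List Bool → X → X
act σ α []          x = x
act σ α (true ∷ w)  x = act σ α w (σ x)
act σ α (false ∷ w) x = act σ α w (α x)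

module _ (P : Presentation) where
  open Presentation P

  Numbers : (f : ℕ → ℕ) (cell dart : ℕ → ℕ) (#cells order : ℕ) → Set
  Numbers f cell dart #cells order =
    (∀ c → c < #cells → dart c < #darts × cell (dart c) ≡ c) ×
    (∀ x → x < #darts → f x < #darts × cell x < #cells × cell (f x) ≡ cell x × fold x f order ≡ x ×
      ∃ λ i → i < order × fold x f i ≡ dart (cell x))

  numbers? : ∀ f cell dart #cells order → Dec (Numbers f cell dart #cells order)
  numbers? f cell dart #cells order =
    allBelow? (λ c → dart c <? #darts ×-dec cell (dart c) ≟ c) #cells ×-dec
    allBelow? (λ x → f x <? #darts ×-dec cell x <? #cells ×-dec cell (f x) ≟ cell x ×-dec fold x f order ≟ x ×-dec
      anyBelow? (λ i → fold x f i ≟ dart (cell x)) order) #darts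

  -- x and z are corners of one face, y and y′ corners of another one at the same
  -- two vertices.
  MeetsProperly : ℕ → ℕ → ℕ → ℕ → Set
  MeetsProperly x y z y′ = z ≢ x → face y′ ≡ face y →
    (z ≡ φ x × face y ≡ face (α x)) ⊎ (x ≡ φ z × face y ≡ face (α z))

  -- The corners of a cell are enumerated by powers of `σ` below `p` or of `φ` below `q`. The
  -- clauses exclude valences 1 and 2, make faces closed discs, and make two faces with two common
  -- vertices adjacent along the edge joining these.
  Polyhedral : Set
  Polyhedral = ∀ x → x < #darts → fold x σ 2 ≢ x ×
    (∀ i → i < q → fold x φ i ≢ x → vertex (fold x φ i) ≢ vertex x × edge (fold x φ i) ≢ edge x) ×
    (∀ j → j < p → face (fold x σ j) ≢ face x → ∀ i → i < q → ∀ k → k < p →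
      MeetsProperly x (fold x σ j) (fold x φ i) (fold (fold x φ i) σ k))

  polyhedral? : Dec Polyhedral
  polyhedral? = allBelow? (λ x → ¬? (fold x σ 2 ≟ x) ×-dec
    allBelow? (λ i → ¬? (fold x φ i ≟ x) →-dec (¬? (vertex (fold x φ i) ≟ vertex x) ×-dec ¬? (edge (fold x φ i) ≟ edge x))) q ×-dec
    allBelow? (λ j → ¬? (face (fold x σ j) ≟ face x) →-dec allBelow? (λ i → allBelow? (λ k →
      meetsProperly? x (fold x σ j) (fold x φ i) (fold (fold x φ i) σ k)) p) q) p) #darts
    where
    meetsProperly? : ∀ x y z y′ → Dec (MeetsProperly x y z y′)
    meetsProperly? x y z y′ = ¬? (z ≟ x) →-dec (face y′ ≟ face y →-dec
      ((z ≟ φ x ×-dec face y ≟ face (α x)) ⊎-dec (x ≟ φ z ×-dec face y ≟ face (α z))))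

  Connected : Set
  Connected = ∀ i → i < ℕ.pred #darts → Any (λ w → act σ α w i ≡ suc i) words

  connected? : Dec Connected
  connected? = allBelow? (λ i → Any.any? (λ w → act σ α w i ≟ suc i) words) (ℕ.pred #darts)

  -- Every condition is decided by evaluation on numerals, so that a concrete presentation is
  -- validated by `tt` alone.
  record Valid : Set where
    constructor valid
    field
      nonempty   : True (0 <? #darts)
      free       : True (allBelow? (λ x → ¬? (α x ≟ x)) #darts)
      vertices   : True (numbers? σ vertex vertexDart #vertices p)
      edges      : True (numbers? α edge edgeDart #edges 2)
      faces      : True (numbers? φ face faceDart #faces q)
      polyhedral : True polyhedral?
      connected  : True connected?

dual : Presentation → Presentation
dual P = record
  { #darts = #darts ; #vertices = #faces ; #edges = #edges ; #faces = #vertices ; p = q ; q = p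
  ; σ = φ ; α = α
  ; vertex = face ; edge = edge ; face = vertex
  ; vertexDart = faceDart ; edgeDart = edgeDart ; faceDart = vertexDart
  -- The rotation of the dual is `φ`, so the letter `σ` becomes `α` followed by `φ`.
  ; words = map (concatMap λ { true → false ∷ true ∷ [] ; false → false ∷ [] }) words
  }
  where open Presentation P

-- Each dart x of a triangulation gives the darts 2x and 2x + 1 of its medial
-- map, on the faces around the vertex of x and in the face of α x.
medial : Presentation → Presentation
medial P = record
  -- With `p` equal to 6, `q = p` is a common multiple of the face sizes `p` and 3.
  { #darts = #darts * 2 ; #vertices = #edges ; #edges = #darts ; #faces = #vertices + #faces ; p = 4 ; q = p
  -- `fold _ σ (p ∸ 1)` is `σ⁻¹`. Around the midpoint of the edge of `x` come `2x`, `2σ⁻¹αx + 1`,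
  -- `2αx` and `2σ⁻¹x + 1`.
  ; σ = λ y → side y (fold (α (y / 2)) σ (p ∸ 1) * 2 + 1) (σ (y / 2) * 2)
  ; α = λ y → side y (y + 1) (y ∸ 1)
  ; vertex = λ y → side y (edge (y / 2)) (edge (σ (y / 2)))
  ; edge = λ y → y / 2
  ; face = λ y → side y (vertex (y / 2)) (#vertices + face (α (y / 2)))
  ; vertexDart = λ c → edgeDart c * 2
  ; edgeDart = λ x → x * 2
  ; faceDart = λ c → choose (does (c <? #vertices)) (vertexDart c * 2) (α (faceDart (c ∸ #vertices)) * 2 + 1)
  -- In the numbering of `triangular`, the long word leads from the last dart at a vertex `v` to the
  -- first one at `v + 1`.
  ; words = (false ∷ []) ∷ (true ∷ []) ∷ (true ∷ true ∷ true ∷ false ∷ true ∷ false ∷ true ∷ false ∷ true ∷ []) ∷ []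
  }
  where
  open Presentation P
  choose : Bool → ℕ → ℕ → ℕ
  choose true  a b = a
  choose false a b = b
  side : ℕ → ℕ → ℕ → ℕ
  side y = choose (does (y % 2 ≟ 0))

private
  _‼_ : List ℕ → ℕ → ℕ
  []       ‼ _     = 0
  (x ∷ xs) ‼ zero  = x
  (x ∷ xs) ‼ suc i = xs ‼ i

-- The Cayley maps of ℤ/n, n = suc m, of valence k (6 or 4), whose dart k·v + d
-- leaves the vertex v in the d-th direction.
triangular : (m b : ℕ) → Presentation
triangular m b = record
  { #darts = n * 6 ; #vertices = n ; #edges = n * 3 ; #faces = n * 2 ; p = 6 ; q = 3
  ; σ = λ x → x / 6 * 6 + suc (x % 6) % 6
  ; α = λ x → (x / 6 + step ‼ (x % 6)) % n * 6 + (3 + x % 6) % 6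
  ; vertex = λ x → x / 6
  ; edge = λ x → (x / 6 + edgeShift ‼ (x % 6)) % n * 3 + x % 6 % 3
  ; face = λ x → (x / 6 + faceShift ‼ (x % 6)) % n * 2 + x % 6 % 2
  ; vertexDart = λ c → c * 6
  ; edgeDart = λ c → c / 3 * 6 + c % 3
  ; faceDart = λ c → c / 2 * 6 + c % 2
  ; words = (true ∷ []) ∷ (true ∷ false ∷ true ∷ true ∷ true ∷ []) ∷ []
  }
  where
  n = suc m
  -- The directions are 1, `b`, `b - 1` and their negatives modulo `n`. An edge is numbered from its
  -- dart in a direction below 3, a face from its dart in direction 0 or 1; the shifts lead to the
  -- tails of these darts.
  step edgeShift faceShift : List ℕ
  step      = 1 ∷ b ∷ b ∸ 1 ∷ m ∷ n ∸ b ∷ suc n ∸ b ∷ []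
  edgeShift = 0 ∷ 0 ∷ 0 ∷ m ∷ n ∸ b ∷ suc n ∸ b ∷ []
  faceShift = 0 ∷ 0 ∷ b ∸ 1 ∷ m ∷ m ∷ n ∸ b ∷ []

quadrangular : (m b : ℕ) → Presentation
quadrangular m b = record
  { #darts = n * 4 ; #vertices = n ; #edges = n * 2 ; #faces = n ; p = 4 ; q = 4
  ; σ = λ x → x / 4 * 4 + suc (x % 4) % 4
  ; α = λ x → (x / 4 + step ‼ (x % 4)) % n * 4 + (2 + x % 4) % 4
  ; vertex = λ x → x / 4
  ; edge = λ x → (x / 4 + edgeShift ‼ (x % 4)) % n * 2 + x % 4 % 2
  ; face = λ x → (x / 4 + faceShift ‼ (x % 4)) % n
  ; vertexDart = λ c → c * 4
  ; edgeDart = λ c → c / 2 * 4 + c % 2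
  ; faceDart = λ c → c * 4
  ; words = (true ∷ []) ∷ (true ∷ false ∷ true ∷ true ∷ []) ∷ []
  }
  where
  n = suc m
  -- The directions are 1, `b` and their negatives; each face has one dart in direction 0, whose
  -- tail numbers it.
  step edgeShift faceShift : List ℕ
  step      = 1 ∷ b ∷ m ∷ n ∸ b ∷ []
  edgeShift = 0 ∷ 0 ∷ m ∷ n ∸ b ∷ []
  faceShift = 0 ∷ b ∷ b ∸ 1 ∷ m ∷ []

-- Proper intersections from shared corners

module _ (E : CellularEmbedding) where
  open CellularEmbedding E

  SharedCornersAdjacent : Set
  SharedCornersAdjacent = ∀ {x y z y′} → face z ≡ face x → face y′ ≡ face y → face y ≢ face x →
    vertex y ≡ vertex x → vertex y′ ≡ vertex z → z ≢ x →
    (z ≡ φ x × face y ≡ face (α x)) ⊎ (x ≡ φ z × face y ≡ face (α z))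

  -- If the faces share an edge, a further common vertex would force a second common edge next to
  -- it, which `not-consecutive` excludes. If they share none, two common vertices would produce
  -- one.
  sharedCornersAdjacent⇒properIntersections : ClosedDiscs → (∀ x → σ (σ x) ≢ x) → SharedCornersAdjacent → ProperIntersections
  sharedCornersAdjacent⇒properIntersections discs σ²-free adjacent f g f≢g = meet
    where
    vertex-φ : ∀ x → vertex (φ x) ≡ vertex (α x)
    vertex-φ x = cycle-step vertices-cycles (α x)
    face-φ : ∀ x → face (φ x) ≡ face x
    face-φ = cycle-step faces-cycles

    -- Two consecutive edges of a face cannot both lie on another face g:
    -- that face would pass twice through their common end.
    not-consecutive : ∀ {x z} → x ≡ φ z → face (α x) ≡ g → face (α z) ≢ g
    not-consecutive {x} {z} refl αx∈g αz∈g = σ²-free (α z)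
      (proj₁ (discs (σ (σ (α z))) (α z) (trans (trans (sym (cong face (cong σ (α-involutive x))))
          (face-φ (α x))) (trans αx∈g (sym αz∈g))))
        (trans (cycle-step vertices-cycles _) (cycle-step vertices-cycles _)))

    corners : ∀ {x z y y′} → face x ≡ f → face z ≡ f → face y ≡ g → face y′ ≡ g →
      vertex y ≡ vertex x → vertex y′ ≡ vertex z → z ≡ x ⊎
      (z ≡ φ x × face (α x) ≡ g) ⊎ (x ≡ φ z × face (α z) ≡ g)
    corners {x} {z} x∈f z∈f y∈g y′∈g y∼x y′∼z with z Fin.≟ x
    ... | yes z≡x = inj₁ z≡x
    ... | no  z≢x with adjacent (trans z∈f (sym x∈f)) (trans y′∈g (sym y∈g))
          (λ eq → f≢g (trans (sym x∈f) (trans (sym eq) y∈g))) y∼x y′∼z z≢x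
    ...   | inj₁ (eq , αx∈) = inj₂ (inj₁ (eq , trans (sym αx∈) y∈g))
    ...   | inj₂ (eq , αz∈) = inj₂ (inj₂ (eq , trans (sym αz∈) y∈g))

    common-edge : ∀ {e} → e ⊂ᶠ f → e ⊂ᶠ g → ∃ λ x → edge x ≡ e × face x ≡ f × face (α x) ≡ g
    common-edge (x , x∈f , refl) (y , y∈g , e≡) with edge-darts E (sym e≡)
    ... | inj₁ refl = contradiction (trans (sym x∈f) y∈g) f≢g
    ... | inj₂ refl = x , refl , x∈f , y∈g

    meet : MeetEmpty f g ⊎ ∃ (MeetInVertex f g) ⊎ ∃ (MeetInEdge f g)
    meet with Fin.any? (λ w → face w Fin.≟ f ×-dec face (α w) Fin.≟ g)
    ... | yes (w , w∈f , αw∈g) = inj₂ (inj₂ (edge w , vertices , edges))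
      where
      w∈g : face (φ (α w)) ≡ g
      w∈g = trans (face-φ (α w)) αw∈g
      w∼ : vertex (φ (α w)) ≡ vertex w
      w∼ = trans (vertex-φ (α w)) (cong vertex (α-involutive w))
      vertices : ∀ v → (v ∈ᶠ f × v ∈ᶠ g) ⇔ v ∈ᵉ edge w
      vertices v = mk⇔ to from
        where
        to : v ∈ᶠ f × v ∈ᶠ g → v ∈ᵉ edge w
        to ((z , z∈f , refl) , (y , y∈g , y∼z)) with corners w∈f z∈f w∈g y∈g w∼ y∼z
        ... | inj₁ refl               = w , refl , refl
        ... | inj₂ (inj₁ (refl , _))  = α w , cycle-step edges-cycles w , sym (vertex-φ w)
        ... | inj₂ (inj₂ (eq , αz∈g)) = contradiction αz∈g (not-consecutive eq αw∈g)
        from : v ∈ᵉ edge w → v ∈ᶠ f × v ∈ᶠ g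
        from (z , e≡ , refl) with edge-darts E (sym e≡)
        ... | inj₁ refl = (w , w∈f , refl) , (φ (α w) , w∈g , w∼)
        ... | inj₂ refl = (φ w , trans (face-φ w) w∈f , vertex-φ w) , (α w , αw∈g , refl)
      edges : ∀ e → (e ⊂ᶠ f × e ⊂ᶠ g) ⇔ e ≡ edge w
      edges e = mk⇔ to λ { refl → (w , w∈f , refl) , (α w , αw∈g , cycle-step edges-cycles w) }
        where
        to : e ⊂ᶠ f × e ⊂ᶠ g → e ≡ edge w
        to (e⊂f , e⊂g) with common-edge e⊂f e⊂g
        ... | z , refl , z∈f , αz∈g with corners w∈f z∈f w∈g (trans (face-φ (α z)) αz∈g) w∼
                (trans (vertex-φ (α z)) (cong vertex (α-involutive z)))
        ...   | inj₁ refl                = refl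
        ...   | inj₂ (inj₁ (eq , _))     = contradiction αw∈g (not-consecutive eq αz∈g)
        ...   | inj₂ (inj₂ (eq , αz∈g′)) = contradiction αz∈g′ (not-consecutive eq αw∈g)
    ... | no noEdge with Fin.any? (λ x → face x Fin.≟ f ×-dec Fin.any? (λ y → face y Fin.≟ g ×-dec vertex y Fin.≟ vertex x))
    ...   | no noVertex = inj₁ λ { v ((x , x∈f , refl) , (y , y∈g , y∼x)) → noVertex (x , x∈f , y , y∈g , y∼x) }
    ...   | yes (x , x∈f , y , y∈g , y∼x) = inj₂ (inj₁ (vertex x ,
            (λ v → mk⇔ to λ { refl → (x , x∈f , refl) , (y , y∈g , y∼x) }) ,
            λ e (e⊂f , e⊂g) → let w , _ , w∈f , αw∈g = common-edge e⊂f e⊂g in noEdge (w , w∈f , αw∈g)))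
      where
      to : ∀ {v} → v ∈ᶠ f × v ∈ᶠ g → v ≡ vertex x
      to ((z , z∈f , refl) , (y′ , y′∈g , y′∼z)) with corners x∈f z∈f y∈g y′∈g y∼x y′∼z
      ... | inj₁ refl                = refl
      ... | inj₂ (inj₁ (_ , αx∈g))   = contradiction (x , x∈f , αx∈g) noEdge
      ... | inj₂ (inj₂ (_ , αz∈g))   = contradiction (z , z∈f , αz∈g) noEdge

fold-return : ∀ {X : Set} (f : X → X) x n i → i ≤ n → fold x f n ≡ x → fold (fold x f i) f (n ∸ i) ≡ x
fold-return f x n i i≤n eq = trans (sym (fold-+ x f (n ∸ i))) (trans (cong (fold x f) (ℕ.m∸n+n≡m i≤n)) eq)

iterate-ext : ∀ {X : Set} {f g : X → X} → (∀ x → f x ≡ g x) → ∀ x k → iterate f x k ≡ iterate g x k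
iterate-ext         f≗g x zero    = refl
iterate-ext {g = g} f≗g x (suc k) = trans (iterate-ext f≗g _ k) (cong (λ y → iterate g y k) (f≗g x))

IsQuotient-ext : ∀ {A C : Set} {f g : A → A} {q : A → C} → (∀ x → f x ≡ g x) →
  IsQuotient (InCycle f) q → IsQuotient (InCycle g) q
IsQuotient-ext f≗g Q = record
  { surjective = surjective
  ; classes = λ x y → mk⇔ (λ (k , eq) → ⇒ (classes x y) (k , trans (iterate-ext f≗g x k) eq))
      (λ eq → let k , eq′ = ⇐ (classes x y) eq in k , trans (sym (iterate-ext f≗g x k)) eq′)
  }
  where open IsQuotient Q

-- Realising a presentation as a map

module Realisation (P : Presentation) (V : Valid P) where
  private
    module P = Presentation P
    module V = Valid V

    lift : ∀ (f : ℕ → ℕ) {k} → (∀ x → x < P.#darts → f x < k) → Fin P.#darts → Fin k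
    lift f bound x = fromℕ< (bound (toℕ x) (Fin.toℕ<n x))

    toℕ-lift : ∀ f {k} (bound : ∀ x → x < P.#darts → f x < k) x → toℕ (lift f bound x) ≡ f (toℕ x)
    toℕ-lift f bound x = Fin.toℕ-fromℕ< _

  module _ {f cell dart #cells order} (N : Numbers P f cell dart #cells order) where
    private
      onCells = proj₁ N
      onDarts = proj₂ N
      dart-bound : ∀ x → x < P.#darts → f x < P.#darts
      dart-bound x x< = proj₁ (onDarts x x<)
      cell-bound : ∀ x → x < P.#darts → cell x < #cells
      cell-bound x x< = proj₁ (proj₂ (onDarts x x<))

    liftDart : Fin P.#darts → Fin P.#darts
    liftDart = lift f dart-bound

    liftCell : Fin P.#darts → Fin #cells
    liftCell = lift cell cell-bound

    toℕ-dart : ∀ x → toℕ (liftDart x) ≡ f (toℕ x)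
    toℕ-dart = toℕ-lift f dart-bound

    toℕ-cell : ∀ x → toℕ (liftCell x) ≡ cell (toℕ x)
    toℕ-cell = toℕ-lift cell cell-bound

    toℕ-fold : ∀ k x → toℕ (fold x liftDart k) ≡ fold (toℕ x) f k
    toℕ-fold = fold-commute toℕ liftDart f toℕ-dart

    lift-order : ∀ x → fold x liftDart order ≡ x
    lift-order x = Fin.toℕ-injective (trans (toℕ-fold order x)
      (proj₁ (proj₂ (proj₂ (proj₂ (onDarts (toℕ x) (Fin.toℕ<n x)))))))

    liftCell-step : ∀ x → liftCell (liftDart x) ≡ liftCell x
    liftCell-step x = Fin.toℕ-injective (trans (toℕ-cell _) (trans (cong cell (toℕ-dart x))
      (trans (proj₁ (proj₂ (proj₂ (onDarts (toℕ x) (Fin.toℕ<n x))))) (sym (toℕ-cell x)))))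

    liftRepresentative : ∀ c → c < #cells → ∃ λ x → toℕ x ≡ dart c × toℕ (liftCell x) ≡ c
    liftRepresentative c c< = let d< , eq = onCells c c< in
      fromℕ< d< , Fin.toℕ-fromℕ< d< , trans (toℕ-cell _) (trans (cong cell (Fin.toℕ-fromℕ< d<)) eq)

    to-representative : ∀ x → ∃ λ i → i < order × toℕ (fold x liftDart i) ≡ dart (toℕ (liftCell x))
    to-representative x = let i , i< , eq = proj₂ (proj₂ (proj₂ (proj₂ (onDarts (toℕ x) (Fin.toℕ<n x))))) in
      i , i< , trans (toℕ-fold i x) (trans eq (cong dart (sym (toℕ-cell x))))

    liftQuotient : IsQuotient (InCycle liftDart) liftCell
    liftQuotient = record
      { surjective = λ c → let x , _ , eq = liftRepresentative (toℕ c) (Fin.toℕ<n c) in x , Fin.toℕ-injective eq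
      ; classes = λ x y → mk⇔ (λ (k , eq) → trans (sym (constant k x)) (cong liftCell eq)) (joined x y)
      }
      where
      constant : ∀ k x → liftCell (iterate liftDart x k) ≡ liftCell x
      constant zero    x = refl
      constant (suc k) x = trans (constant k _) (liftCell-step x)
      joined : ∀ x y → liftCell x ≡ liftCell y → InCycle liftDart x y
      joined x y eq =
        let i , _  , eqx = to-representative x
            j , j< , eqy = to-representative y
        in (order ∸ j) + i , trans (sym (iterate-is-fold x liftDart ((order ∸ j) + i))) (trans (fold-+ x liftDart (order ∸ j))
            (trans (cong (λ z → fold z liftDart (order ∸ j))
              (Fin.toℕ-injective (trans eqx (trans (cong (dart ∘ toℕ) eq) (sym eqy)))))
              (fold-return liftDart y order j (ℕ.<⇒≤ j<) (lift-order y))))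

    same-liftCell : ∀ {x y} → liftCell x ≡ liftCell y → ∃ λ i → i < order × toℕ y ≡ fold (toℕ x) f i
    same-liftCell {x} {y} eq =
      let i , i< , _ = to-representative x
          instance _ = ℕ.>-nonZero (ℕ.≤-<-trans ℕ.z≤n i<)
          k , eq′ = same-cycle liftQuotient eq
      in k % order , m%n<n k order ,
         trans (cong toℕ (trans (sym eq′) (order-mod liftDart order (lift-order x) k))) (toℕ-fold (k % order) x)

  private
    vertexNumbers = toWitness V.vertices
    edgeNumbers = toWitness V.edges
    faceNumbers = toWitness V.faces

    Dart : Set
    Dart = Fin P.#darts
    σ α : Dart → Dart
    σ = liftDart vertexNumbers
    α = liftDart edgeNumbers

    rotation : Permutation′ P.#darts
    rotation = permutation σ (λ x → fold x σ (P.p ∸ 1)) (λ x → right x) (λ x → trans (fold-shift σ x (P.p ∸ 1)) (right x))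
      where
      right : ∀ x → σ (fold x σ (P.p ∸ 1)) ≡ x
      -- The index `i` below `p` shows that `p` is positive, so one step after `p ∸ 1` steps makes
      -- `p` steps.
      right x with to-representative vertexNumbers x
      ... | i , i<p , _ = trans (cong (fold x σ) (ℕ.m+[n∸m]≡n (ℕ.≤-trans (s≤s ℕ.z≤n) i<p))) (lift-order vertexNumbers x)

    toℕ-φ : ∀ x → toℕ (σ (α x)) ≡ P.φ (toℕ x)
    toℕ-φ x = trans (toℕ-dart vertexNumbers (α x)) (cong P.σ (toℕ-dart edgeNumbers x))

    α-involutive : ∀ x → α (α x) ≡ x
    α-involutive = lift-order edgeNumbers

    liftφ≗φ : ∀ x → liftDart faceNumbers x ≡ σ (α x)
    liftφ≗φ x = Fin.toℕ-injective (trans (toℕ-dart faceNumbers x) (sym (toℕ-φ x)))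

    act-path : ∀ w x → Star (Step σ α) x (act σ α w x)
    act-path []          x = ε
    act-path (true ∷ w)  x = inj₁ refl ◅ act-path w (σ x)
    act-path (false ∷ w) x = inj₂ refl ◅ act-path w (α x)

    toℕ-act : ∀ w x → toℕ (act σ α w x) ≡ act P.σ P.α w (toℕ x)
    toℕ-act []          x = refl
    toℕ-act (true ∷ w)  x = trans (toℕ-act w (σ x)) (cong (act P.σ P.α w) (toℕ-dart vertexNumbers x))
    toℕ-act (false ∷ w) x = trans (toℕ-act w (α x)) (cong (act P.σ P.α w) (toℕ-dart edgeNumbers x))

    origin : Dart
    origin = fromℕ< (toWitness V.nonempty)

    from-origin : ∀ n (n< : n < P.#darts) → Star (Step σ α) origin (fromℕ< n<)
    from-origin zero    n< = subst (Star _ _) (Fin.fromℕ<-cong 0 0 refl (toWitness V.nonempty) n<) ε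
    from-origin (suc n) 1+n< = from-origin n n< ◅◅ subst (Star _ _) arrives (act-path (proj₁ found) x)
      where
      n< = ℕ.<⇒≤ 1+n<
      x = fromℕ< n<
      found : ∃ λ w → act P.σ P.α w n ≡ suc n
      found = Any.satisfied (toWitness V.connected n (ℕ.pred-mono-≤ 1+n<))
      arrives : act σ α (proj₁ found) x ≡ fromℕ< 1+n<
      arrives = Fin.toℕ-injective (trans (toℕ-act (proj₁ found) x)
        (trans (cong (act P.σ P.α (proj₁ found)) (Fin.toℕ-fromℕ< n<)) (trans (proj₂ found) (sym (Fin.toℕ-fromℕ< 1+n<)))))

    σ-orbit : ∀ k x → Star (Step σ α) x (fold x σ k)
    σ-orbit zero    x = ε
    σ-orbit (suc k) x = σ-orbit k x ◅◅ inj₁ refl ◅ ε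

    step-back : ∀ {x y} → Step σ α x y → Star (Step σ α) y x
    step-back {x} (inj₁ refl) = subst (Star _ _) (inverseˡ rotation {x}) (σ-orbit (P.p ∸ 1) (σ x))
    step-back {x} (inj₂ refl) = inj₂ (α-involutive x) ◅ ε

    connected : ∀ x y → Star (Step σ α) x y
    connected x y = back (reach x) ◅◅ reach y
      where
      back : ∀ {x y} → Star (Step σ α) x y → Star (Step σ α) y x
      back ε        = ε
      back (s ◅ xs) = back xs ◅◅ step-back s
      reach : ∀ x → Star (Step σ α) origin x
      reach x = subst (Star _ _) (Fin.fromℕ<-toℕ x (Fin.toℕ<n x)) (from-origin (toℕ x) (Fin.toℕ<n x))

  embedding : CellularEmbedding
  embedding = record
    { #darts = P.#darts ; #vertices = P.#vertices ; #edges = P.#edges ; #faces = P.#faces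
    ; rotation = rotation
    ; α = α
    ; α-involutive = α-involutive
    ; α-fixedPointFree = λ x eq → toWitness V.free (toℕ x) (Fin.toℕ<n x) (trans (sym (toℕ-dart edgeNumbers x)) (cong toℕ eq))
    ; vertex = liftCell vertexNumbers
    ; edge = liftCell edgeNumbers
    ; face = liftCell faceNumbers
    ; vertices-cycles = liftQuotient vertexNumbers
    ; edges-cycles = liftQuotient edgeNumbers
    ; faces-cycles = IsQuotient-ext liftφ≗φ (liftQuotient faceNumbers)
    ; nonempty = toWitness V.nonempty
    ; connected = connected
    }

  private
    open module E = CellularEmbedding embedding using (vertex; edge; face; ClosedDiscs; ProperIntersections)

    polyhedral : Polyhedral P
    polyhedral = toWitness V.polyhedral

    face≡ : ∀ {x y} → face x ≡ face y → P.face (toℕ x) ≡ P.face (toℕ y)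
    face≡ {x} {y} eq = trans (sym (toℕ-cell faceNumbers x)) (trans (cong toℕ eq) (toℕ-cell faceNumbers y))

    toℕ-face : ∀ x → toℕ (face x) ≡ P.face (toℕ x)
    toℕ-face = toℕ-cell faceNumbers

  closedDiscs : ClosedDiscs
  closedDiscs x y f≡ =
    (λ v≡ → Fin.toℕ-injective (distinct (same-liftCell faceNumbers f≡) (inj₁ (numbers vertexNumbers v≡)))) ,
    (λ e≡ → Fin.toℕ-injective (distinct (same-liftCell faceNumbers f≡) (inj₂ (numbers edgeNumbers e≡))))
    where
    numbers : ∀ {f cell dart #cells order} (N : Numbers P f cell dart #cells order) →
      liftCell N x ≡ liftCell N y → cell (toℕ y) ≡ cell (toℕ x)
    numbers N eq = trans (sym (toℕ-cell N y)) (trans (sym (cong toℕ eq)) (toℕ-cell N x))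
    distinct : ∀ {y} → (∃ λ i → i < P.q × y ≡ fold (toℕ x) P.φ i) →
      P.vertex y ≡ P.vertex (toℕ x) ⊎ P.edge y ≡ P.edge (toℕ x) → toℕ x ≡ y
    distinct (i , i<q , refl) same = sym (decidable-stable (_ ≟ _) λ ≢x →
      let v≢ , e≢ = proj₁ (proj₂ (polyhedral (toℕ x) (Fin.toℕ<n x))) i i<q ≢x in [ v≢ , e≢ ]′ same)

  properIntersections : ProperIntersections
  properIntersections = sharedCornersAdjacent⇒properIntersections embedding closedDiscs
    (λ x eq → proj₁ (polyhedral (toℕ x) (Fin.toℕ<n x)) (trans (sym (toℕ-fold vertexNumbers 2 x)) (cong toℕ eq)))
    adjacent
    where
    corners : ∀ {x y z y′} → x < P.#darts → (∃ λ j → j < P.p × y ≡ fold x P.σ j) →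
      (∃ λ i → i < P.q × z ≡ fold x P.φ i) → (∃ λ k → k < P.p × y′ ≡ fold z P.σ k) →
      P.face y ≢ P.face x → MeetsProperly P x y z y′
    corners x< (j , j<p , refl) (i , i<q , refl) (k , k<p , refl) y≁x =
      proj₂ (proj₂ (polyhedral _ x<)) j j<p y≁x i i<q k k<p
    adjacent : SharedCornersAdjacent embedding
    adjacent {x} {y} {z} {y′} z∼x y′∼y y≁x y∼x y′∼z z≢x =
      [ (λ (eq , f≡) → inj₁ (Fin.toℕ-injective (trans eq (sym (toℕ-φ x))) , face-α x f≡))
      , (λ (eq , f≡) → inj₂ (Fin.toℕ-injective (trans eq (sym (toℕ-φ z))) , face-α z f≡)) ]′
      (corners (Fin.toℕ<n x) (same-liftCell vertexNumbers (sym y∼x)) (same-liftCell faceNumbers (sym z∼x))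
        (same-liftCell vertexNumbers (sym y′∼z))
        (λ eq → y≁x (Fin.toℕ-injective (trans (toℕ-face y) (trans eq (sym (toℕ-face x))))))
        (λ eq → z≢x (Fin.toℕ-injective eq)) (face≡ y′∼y))
      where
      face-α : ∀ w → P.face (toℕ y) ≡ P.face (P.α (toℕ w)) → face y ≡ face (α w)
      face-α w eq = Fin.toℕ-injective (trans (toℕ-face y) (trans eq
        (sym (trans (toℕ-face (α w)) (cong P.face (toℕ-dart edgeNumbers w))))))

  realisation : Map
  realisation = record { embedding = embedding ; closedDiscs = closedDiscs ; properIntersections = properIntersections }

-- Numerical invariants of edges

does-⇔ : {P Q : Set} → P ⇔ Q → (p : Dec P) (q : Dec Q) → does p ≡ does q
does-⇔ P⇔Q (yes _) (yes _) = refl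
does-⇔ P⇔Q (yes p) (no ¬q) = contradiction (⇒ P⇔Q p) ¬q
does-⇔ P⇔Q (no ¬p) (yes q) = contradiction (⇐ P⇔Q q) ¬p
does-⇔ P⇔Q (no _)  (no _)  = refl

-- Automorphisms preserve the relation "u and v lie on a common face", hence
-- the numbers of pairs w, x standing in given such relations to u and v.
module _ (K : Map) where
  open Map K

  Cofacial : Vertex → Vertex → Set
  Cofacial u v = ∃ λ f → u ∈ᶠ f × v ∈ᶠ f

  module Weight (cofacial? : ∀ u v → Dec (Cofacial u v))
    (P : Bool → Bool → Bool) (Q : Bool → Bool → Bool → Bool) where

    private
      c : Vertex → Vertex → Bool
      c u v = does (cofacial? u v)

      indicator : Bool → ℕ
      indicator b = if b then 1 else 0

      inner : Vertex → Vertex → Vertex → Vertex → ℕ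
      inner u v w x = indicator (Q (c u x) (c w x) (c x v))

      outer : Vertex → Vertex → Vertex → ℕ
      outer u v w = if P (c u w) (c w v) then sum (inner u v w) else 0

    pairs : Vertex → Vertex → ℕ
    pairs u v = sum (outer u v)

    weight : Dart → ℕ
    weight x = pairs (vertex x) (vertex (α x))

    module _ (π : Permutation′ #vertices) (automorphism : IsAutomorphism K π) where
      private
        c-invariant : ∀ u v → c (π ⟨$⟩ʳ u) (π ⟨$⟩ʳ v) ≡ c u v
        c-invariant u v = does-⇔ (mk⇔
          (λ (f , u∈f , v∈f) → let f′ , maps = proj₂ (proj₂ automorphism) f in
            f′ , subst (_∈ᶠ f′) (inverseˡ π) (⇒ (maps _) u∈f) , subst (_∈ᶠ f′) (inverseˡ π) (⇒ (maps _) v∈f))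
          (λ (f , u∈f , v∈f) → let f′ , maps = proj₂ (proj₁ automorphism) f in
            f′ , ⇒ (maps u) u∈f , ⇒ (maps v) v∈f))
          (cofacial? _ _) (cofacial? u v)

      pairs-invariant : ∀ u v → pairs (π ⟨$⟩ʳ u) (π ⟨$⟩ʳ v) ≡ pairs u v
      pairs-invariant u v = trans (sum-permute (outer (π ⟨$⟩ʳ u) (π ⟨$⟩ʳ v)) π)
        (sum-cong-≗ λ w → cong₂ (λ b n → if b then n else 0)
        (cong₂ P (c-invariant u w) (c-invariant w v))
        (trans (sum-permute (inner (π ⟨$⟩ʳ u) (π ⟨$⟩ʳ v) (π ⟨$⟩ʳ w)) π) (sum-cong-≗ λ x →
          cong indicator (cong₃ Q (c-invariant u x) (c-invariant w x) (c-invariant x v)))))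
        where
        cong₃ : {A B : Set} (f : A → A → A → B) {a a′ b b′ c c′ : A} →
          a ≡ a′ → b ≡ b′ → c ≡ c′ → f a b c ≡ f a′ b′ c′
        cong₃ f refl refl refl = refl

    -- The ends of one edge go to the ends of the other in either order, whence the two
    -- alternatives. Without a loop, they cannot both go to the end belonging to one dart.
    weight-invariant : ∀ {x y} → vertex x ≢ vertex (α x) → SameOrbit K (edge x) (edge y) →
      weight x ≡ weight y ⊎ weight x ≡ weight (α y)
    weight-invariant {x} {y} noLoop (π , automorphism , maps) =
      Sum.map (trans invariant) (trans invariant) (ends (⇒ (maps (vertex x)) (x , refl , refl))
        (⇒ (maps (vertex (α x))) (α x , cycle-step edges-cycles x , refl)))
      where
      invariant : weight x ≡ pairs (π ⟨$⟩ʳ vertex x) (π ⟨$⟩ʳ vertex (α x))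
      invariant = sym (pairs-invariant π automorphism (vertex x) (vertex (α x)))
      π-injective : ∀ {u v} → π ⟨$⟩ʳ u ≡ π ⟨$⟩ʳ v → u ≡ v
      π-injective eq = trans (sym (inverseˡ π)) (trans (cong (flip π ⟨$⟩ʳ_) eq) (inverseˡ π))
      ends : (π ⟨$⟩ʳ vertex x) ∈ᵉ edge y → (π ⟨$⟩ʳ vertex (α x)) ∈ᵉ edge y →
        pairs (π ⟨$⟩ʳ vertex x) (π ⟨$⟩ʳ vertex (α x)) ≡ weight y ⊎
        pairs (π ⟨$⟩ʳ vertex x) (π ⟨$⟩ʳ vertex (α x)) ≡ weight (α y)
      ends (a , a∈ , a≡) (b , b∈ , b≡) with edge-darts embedding (sym a∈) | edge-darts embedding (sym b∈)
      ... | inj₁ refl | inj₁ refl = contradiction (π-injective (trans (sym a≡) b≡)) noLoop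
      ... | inj₁ refl | inj₂ refl = inj₁ (sym (cong₂ pairs a≡ b≡))
      ... | inj₂ refl | inj₁ refl = inj₂ (sym (cong₂ pairs a≡ (trans (cong vertex (α-involutive y)) b≡)))
      ... | inj₂ refl | inj₂ refl = contradiction (π-injective (trans (sym a≡) b≡)) noLoop

    -- A weight may depend on the order of the ends, so it separates edges only when both darts of
    -- an edge have the same one.
    distinct-weights : ∀ {h} (s : Fin h → Dart) (n : Fin h → ℕ) → (∀ i → vertex (s i) ≢ vertex (α (s i))) →
      (∀ i → weight (s i) ≡ n i × weight (α (s i)) ≡ n i) → (∀ i j → n i ≡ n j → i ≡ j) →
      ∀ i j → SameOrbit K (edge (s i)) (edge (s j)) → i ≡ j
    distinct-weights s n noLoop weights n-injective i j same = n-injective i j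
      ([ (λ eq → trans (sym (proj₁ (weights i))) (trans eq (proj₁ (weights j))))
       , (λ eq → trans (sym (proj₁ (weights i))) (trans eq (proj₂ (weights j)))) ]′ (weight-invariant (noLoop i) same))

-- Checking symbols and cofaciality by evaluation

module _ (P : Presentation) where
  open Presentation P

  Period : (ℕ → ℕ) → ℕ → ℕ → Set
  Period f x n = 0 < n × fold x f n ≡ x × (∀ i → i < n → 0 < i → fold x f i ≢ x)

  period? : ∀ f x n → Dec (Period f x n)
  period? f x n = 0 <? n ×-dec fold x f n ≟ x ×-dec allBelow? (λ i → 0 <? i →-dec ¬? (fold x f i ≟ x)) n

  Periods : (ℕ → ℕ) → ℕ → ℕ → ℕ → Set
  Periods f x m n = (Period f x m × Period f (α x) n) ⊎ (Period f x n × Period f (α x) m)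

  periods? : ∀ f x m n → Dec (Periods f x m n)
  periods? f x m n = (period? f x m ×-dec period? f (α x) n) ⊎-dec (period? f x n ×-dec period? f (α x) m)

  Homogeneous : EdgeSymbol → Set
  Homogeneous (m , ℓ , u , v) = ∀ e → e < #edges → Periods φ (edgeDart e) m ℓ × Periods σ (edgeDart e) u v

  homogeneous? : ∀ s → Dec (Homogeneous s)
  homogeneous? (m , ℓ , u , v) = allBelow? (λ e → periods? φ (edgeDart e) m ℓ ×-dec periods? σ (edgeDart e) u v) #edges

  star : ℕ → ℕ → List ℕ
  star x zero    = []
  star x (suc k) = face x ∷ star (σ x) k

  ∈-star⁺ : ∀ x {k j} → j < k → face (fold x σ j) ∈ star x k
  ∈-star⁺ x {suc k} {zero}  _         = here refl
  ∈-star⁺ x {suc k} {suc j} (s≤s j<k) = there (subst (λ y → face y ∈ star (σ x) k) (fold-shift σ x j) (∈-star⁺ (σ x) j<k))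

  ∈-star⁻ : ∀ x k {f} → f ∈ star x k → ∃ λ j → f ≡ face (fold x σ j)
  ∈-star⁻ x (suc k) (here refl) = 0 , refl
  ∈-star⁻ x (suc k) (there f∈)  = let j , eq = ∈-star⁻ (σ x) k f∈ in suc j , trans eq (cong face (fold-shift σ x j))

Meet : List ℕ → List ℕ → Set
Meet xs ys = Any (_∈ ys) xs

meet? : ∀ xs ys → Dec (Meet xs ys)
meet? xs ys = any? (λ x → any? (x ≟_) ys) xs

module RealisationProperties (P : Presentation) (V : Valid P) where
  private
    module P = Presentation P
    K = Realisation.realisation P V
    open Realisation P V
    open Map K
    vertexNumbers = toWitness (Valid.vertices V)
    edgeNumbers = toWitness (Valid.edges V)
    faceNumbers = toWitness (Valid.faces V)

    toℕ-φ : ∀ x → toℕ (φ x) ≡ P.φ (toℕ x)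
    toℕ-φ x = trans (toℕ-dart vertexNumbers (α x)) (cong P.σ (toℕ-dart edgeNumbers x))

    lift-period : ∀ {f : Dart → Dart} {g} → (∀ x → toℕ (f x) ≡ g (toℕ x)) → ∀ x {n} → Period P g (toℕ x) n → IsPeriod f x n
    lift-period {f} {g} f≡g x {n} (pos , ret , min) = record
      { positive = pos
      ; returns = Fin.toℕ-injective (trans (fold-commute toℕ f g f≡g n x) ret)
      ; minimal = λ i 0<i i<n eq → min i i<n 0<i (trans (sym (fold-commute toℕ f g f≡g i x)) (cong toℕ eq))
      }

    edgeHomogeneous : ∀ {s} → Homogeneous P s → EdgeHomogeneous K s
    edgeHomogeneous {m , ℓ , u , v} hom e = x , Fin.toℕ-injective (proj₂ (proj₂ found)) ,
      pair toℕ-φ faces-cycles (proj₁ (hom (toℕ e) (Fin.toℕ<n e))) ,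
      pair (toℕ-dart vertexNumbers) vertices-cycles (proj₂ (hom (toℕ e) (Fin.toℕ<n e)))
      where
      found = liftRepresentative edgeNumbers (toℕ e) (Fin.toℕ<n e)
      x = proj₁ found
      x≡ : toℕ x ≡ P.edgeDart (toℕ e)
      x≡ = proj₁ (proj₂ found)
      αx≡ : toℕ (α x) ≡ P.α (P.edgeDart (toℕ e))
      αx≡ = trans (toℕ-dart edgeNumbers x) (cong P.α x≡)
      -- This unfolds to `valence (vertex x)` as well as to `size (face x)`, so that `pair` serves
      -- both halves of the symbol.
      cardinality : ∀ {c} → (Dart → Fin c) → Dart → ℕ
      cardinality q x = length (filter (λ y → q y Fin.≟ q x) (allFin #darts))
      length≡ : ∀ {f : Dart → Dart} {g} → (∀ x → toℕ (f x) ≡ g (toℕ x)) →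
        ∀ {c} {q : Dart → Fin c} → IsQuotient (InCycle f) q →
        ∀ x {y} → toℕ x ≡ y → ∀ {n} → Period P g y n → cardinality q x ≡ n
      length≡ f≡g Q x refl per = IsPeriod-unique (cycle-length Q x) (lift-period f≡g x per)
      pair : ∀ {f : Dart → Dart} {g} → (∀ x → toℕ (f x) ≡ g (toℕ x)) →
        ∀ {c} {q : Dart → Fin c} (Q : IsQuotient (InCycle f) q) →
        ∀ {m n} → Periods P g (P.edgeDart (toℕ e)) m n → SamePair (cardinality q x) (cardinality q (α x)) m n
      pair f≡g Q = Sum.map
        (λ (a , b) → length≡ f≡g Q x x≡ a , length≡ f≡g Q (α x) αx≡ b)
        (λ (a , b) → length≡ f≡g Q x x≡ a , length≡ f≡g Q (α x) αx≡ b)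

  homogeneous : ∀ s → True (homogeneous? P s) → EdgeHomogeneous K s
  homogeneous s checked = edgeHomogeneous {s} (toWitness checked)

  -- Comparing two short lists of face numbers, instead of searching all faces and darts, keeps the
  -- sums in `weight` cheap to evaluate. A list may repeat faces, since `p` is only a multiple of
  -- the valence.
  cofacial? : ∀ u v → Dec (Cofacial K u v)
  cofacial? u v = map′ to from (meet? (starAt u) (starAt v))
    where
    starAt : Vertex → List ℕ
    starAt v = star P (P.vertexDart (toℕ v)) P.p
    at : ∀ v → ∃ λ x → toℕ x ≡ P.vertexDart (toℕ v) × vertex x ≡ v
    at v = let x , x≡ , v≡ = liftRepresentative vertexNumbers (toℕ v) (Fin.toℕ<n v) in x , x≡ , Fin.toℕ-injective v≡
    toℕ-face : ∀ v k → toℕ (face (fold (proj₁ (at v)) σ k)) ≡ P.face (fold (P.vertexDart (toℕ v)) P.σ k)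
    toℕ-face v k = trans (toℕ-cell faceNumbers _) (cong P.face (trans (toℕ-fold vertexNumbers k _)
      (cong (λ n → fold n P.σ k) (proj₁ (proj₂ (at v))))))
    vertex-at : ∀ v k → vertex (fold (proj₁ (at v)) σ k) ≡ v
    vertex-at v k = trans (cycle-fold vertices-cycles _ k) (proj₂ (proj₂ (at v)))
    to : Meet (starAt u) (starAt v) → Cofacial K u v
    to met with f , f∈u , f∈v ← find met
      with j , refl ← ∈-star⁻ P _ P.p f∈u | k , eq ← ∈-star⁻ P _ P.p f∈v =
      face (fold (proj₁ (at v)) σ k) ,
      (fold (proj₁ (at u)) σ j , Fin.toℕ-injective (trans (toℕ-face u j) (trans eq (sym (toℕ-face v k)))) , vertex-at u j) ,
      (fold (proj₁ (at v)) σ k , refl , vertex-at v k)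
    corner : ∀ {v f} → v ∈ᶠ f → ∃ λ k → k < P.p × P.face (fold (P.vertexDart (toℕ v)) P.σ k) ≡ toℕ f
    corner {v} (x , refl , v≡) =
      let k , k<p , eq = same-liftCell vertexNumbers (trans (proj₂ (proj₂ (at v))) (sym v≡)) in
      k , k<p , trans (cong P.face (trans (cong (λ n → fold n P.σ k) (sym (proj₁ (proj₂ (at v))))) (sym eq)))
        (sym (toℕ-cell faceNumbers x))
    from : Cofacial K u v → Meet (starAt u) (starAt v)
    from (f , u∈f , v∈f) =
      let j , j<p , eq = corner u∈f ; k , k<p , eq′ = corner v∈f in
      lose (∈-star⁺ P (P.vertexDart (toℕ u)) j<p)
        (subst (_∈ starAt v) (trans eq′ (sym eq)) (∈-star⁺ P (P.vertexDart (toℕ v)) k<p))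

module _ (P : Presentation) (V : Valid P) where
  private
    K = Realisation.realisation P V
    open Map K

  module _ (A : Bool → Bool → Bool) (B : Bool → Bool → Bool → Bool) where
    open Weight K (RealisationProperties.cofacial? P V) A B

    Distinguishes : ∀ {h} → Vec Dart h → Vec ℕ h → Set
    Distinguishes s n =
      (∀ i → vertex (lookup s i) ≢ vertex (α (lookup s i)) ×
        weight (lookup s i) ≡ lookup n i × weight (α (lookup s i)) ≡ lookup n i) ×
      (∀ i j → lookup n i ≡ lookup n j → i ≡ j)

    distinguishes? : ∀ {h} (s : Vec Dart h) n → Dec (Distinguishes s n)
    distinguishes? s n =
      Fin.all? (λ i → ¬? (vertex (lookup s i) Fin.≟ vertex (α (lookup s i))) ×-dec
        weight (lookup s i) ≟ lookup n i ×-dec weight (α (lookup s i)) ≟ lookup n i) ×-dec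
      Fin.all? (λ i → Fin.all? λ j → lookup n i ≟ lookup n j →-dec i Fin.≟ j)

    attains : ∀ s {h} → (∀ K → EdgeHomogeneous K s → OrbitRepresentatives K h) →
      OnTorus K → True (homogeneous? P s) → ∀ darts weights → True (distinguishes? {h} darts weights) →
      ∃ λ (K : Map) → OnTorus K × EdgeHomogeneous K s × HasEdgeOrbits K h
    attains s representatives torus hom darts weights checked = K , torus , hom′ ,
      inequivalent⇒hasEdgeOrbits K (representatives K hom′) (λ i → edge (lookup darts i))
        (distinct-weights (lookup darts) (lookup weights) (λ i → proj₁ (distinct i)) (λ i → proj₂ (distinct i)) injective)
      where
      hom′ = RealisationProperties.homogeneous P V s hom
      distinct = proj₁ (toWitness checked)
      injective = proj₂ (toWitness checked)

-- Maps attaining the bounds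

isolated : Bool → Bool → Bool
isolated uw wv = uw ∧ not wv

-- With these weights `pairs u v` counts the w and x for which u, w, x, v is an
-- induced path in the graph of Cofacial, hence, for the ends u and v of an
-- edge, an induced 4-cycle.
inducedPath : Bool → Bool → Bool → Bool
inducedPath ux wx xv = not ux ∧ wx ∧ xv

valid-3366 : Valid (triangular 8 3)
valid-3366 = valid tt tt tt tt tt tt tt

-- Darts 0, 1, 2 leave vertex 0 by the steps 1, 3, 2 of ℤ/9, one for each pair of opposite
-- directions; the second list holds their weights.
attained-3366 : ∃ λ (K : Map) → OnTorus K × EdgeHomogeneous K (3 , 3 , 6 , 6) × HasEdgeOrbits K 3
attained-3366 = attains (triangular 8 3) valid-3366 isolated inducedPath _ orbits-3366 refl tt
  (# 0 ∷ # 1 ∷ # 2 ∷ []) (1 ∷ 3 ∷ 4 ∷ []) tt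

valid-6633 : Valid (dual (triangular 8 3))
valid-6633 = valid tt tt tt tt tt tt tt

attained-6633 : ∃ λ (K : Map) → OnTorus K × EdgeHomogeneous K (6 , 6 , 3 , 3) × HasEdgeOrbits K 3
attained-6633 = attains (dual (triangular 8 3)) valid-6633 isolated inducedPath _ orbits-6633 refl tt
  (# 0 ∷ # 1 ∷ # 2 ∷ []) (7 ∷ 0 ∷ 4 ∷ []) tt

valid-3644 : Valid (medial (triangular 9 3))
valid-3644 = valid tt tt tt tt tt tt tt

-- Darts 0, 2, 4 come from the corners of the triangulation following its darts 0, 1, 2, and so lie
-- on one hexagon.
attained-3644 : ∃ λ (K : Map) → OnTorus K × EdgeHomogeneous K (3 , 6 , 4 , 4) × HasEdgeOrbits K 3
attained-3644 = attains (medial (triangular 9 3)) valid-3644 isolated inducedPath _ orbits-3644 refl tt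
  (# 0 ∷ # 2 ∷ # 4 ∷ []) (2 ∷ 3 ∷ 1 ∷ []) tt

valid-4436 : Valid (dual (medial (triangular 8 3)))
valid-4436 = valid tt tt tt tt tt tt tt

-- Induced 4-cycles do not separate the classes here; walks of length 3 do.
attained-4436 : ∃ λ (K : Map) → OnTorus K × EdgeHomogeneous K (4 , 4 , 3 , 6) × HasEdgeOrbits K 3
attained-4436 = attains (dual (medial (triangular 8 3))) valid-4436
  (λ uw wv → uw) (λ ux wx xv → wx ∧ xv) _ orbits-4436 refl tt
  (# 0 ∷ # 2 ∷ # 4 ∷ []) (49 ∷ 48 ∷ 50 ∷ []) tt

valid-4444 : Valid (quadrangular 10 3)
valid-4444 = valid tt tt tt tt tt tt tt

-- In ℤ/11 with steps 1 and 3, the weights exclude every automorphism exchanging the two directions,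
-- reflections included.
attained-4444 : ∃ λ (K : Map) → OnTorus K × EdgeHomogeneous K (4 , 4 , 4 , 4) × HasEdgeOrbits K 2
attained-4444 = attains (quadrangular 10 3) valid-4444 isolated inducedPath _ orbits-4444 refl tt
  (# 0 ∷ # 1 ∷ []) (1 ∷ 4 ∷ []) tt

theorem1p4 :
  let symbolsA : List EdgeSymbol
      symbolsA = (3 , 3 , 6 , 6) ∷ (6 , 6 , 3 , 3) ∷ (3 , 6 , 4 , 4) ∷ (4 , 4 , 3 , 6) ∷ []
      symbolB : EdgeSymbol
      symbolB = (4 , 4 , 4 , 4)
  in
  (∀ (K : Map) (s : EdgeSymbol) (N : ℕ) →
     OnTorus K → EdgeHomogeneous K s → HasEdgeOrbits K N →
     (s ∈ symbolsA → N ≤ 3) × (s ≡ symbolB → N ≤ 2))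
  × (∀ s → s ∈ symbolsA →
       ∃ λ (K : Map) → OnTorus K × EdgeHomogeneous K s × HasEdgeOrbits K 3)
  × (∃ λ (K : Map) → OnTorus K × EdgeHomogeneous K symbolB × HasEdgeOrbits K 2)
theorem1p4 =
  (λ K s N _ homogeneous orbits →
    (λ { (here refl)                          → orbits-≤ K (orbits-3366 K homogeneous) orbits
       ; (there (here refl))                  → orbits-≤ K (orbits-6633 K homogeneous) orbits
       ; (there (there (here refl)))          → orbits-≤ K (orbits-3644 K homogeneous) orbits
       ; (there (there (there (here refl))))  → orbits-≤ K (orbits-4436 K homogeneous) orbits }) ,
    λ { refl → orbits-≤ K (orbits-4444 K homogeneous) orbits }) ,
  (λ { _ (here refl)                          → attained-3366
     ; _ (there (here refl))                  → attained-6633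
     ; _ (there (there (here refl)))          → attained-3644
     ; _ (there (there (there (here refl))))  → attained-4436 }) ,
  attained-4444
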